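{- There exists a collapsible simplicial $3$-ball $B$ such that for any facet $\sigma$ of the boundary $\partial B$, the ball $B$ does not collapse onto $\partial B-\sigma$.
   Context: All complexes are finite. A simplicial $3$-ball is a simplicial complex whose underlying space is homeomorphic to the $3$-ball. The facets of $\partial B$ are the boundary triangles; $\partial B-\sigma$ is $\partial B$ with only the face $\sigma$ removed (its edges and vertices are kept). Collapse: an elementary collapse removes from a complex a pair of faces $(\sigma,\Sigma)$ with $\dim\Sigma=\dim\sigma+1$, $\sigma$ a proper face of $\Sigma$ and of no other face. $C$ collapses onto $D$ if $D$ is obtained from $C$ by a finite sequence of elementary collapses; $C$ is collapsible if it collapses onto a single vertex. -}

module Defs where

open import Level using (0ℓ; suc)
open import Algebra.Bundles using (CommutativeRing)
import Algebra.Properties.Semiring.Sum as SemiringSum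
import Relation.Binary.Construct.NonStrictToStrict as NonStrictToStrict
import Relation.Binary.Construct.On as On
open import Data.Bool.Properties using () renaming (_≟_ to _≟ᵇ_)
open import Data.Fin.Base using (Fin)
open import Data.Fin.Subset
  using (Subset; _∈_; _∉_; _⊆_; _⊂_; Nonempty; ∣_∣; ⁅_⁆)
open import Data.Fin.Subset.Properties
  using (x∈⁅x⁆; x∈⁅y⁆⇒x≡y; ⊆-antisym; ⊆-trans; _⊆?_; nonempty?; anySubset?)
open import Data.Nat.Base as ℕ using (ℕ)
import Data.Nat.Properties as ℕ
open import Data.Product using (Σ; ∃; ∃!; ∃-syntax; _×_; _,_; proj₁)
open import Data.Vec.Functional using (Vector)
import Data.Vec.Functional.Relation.Binary.Equality.Setoid as VectorEquality
import Data.Vec.Properties as Vec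
open import Function.Base using (_∘_)
open import Function.Bundles using (Inverse; _⇔_)
open import Relation.Binary.Bundles using (Setoid)
open import Relation.Binary.Construct.Closure.ReflexiveTransitive using (Star)
open import Relation.Binary.Core using (Rel)
open import Relation.Binary.Definitions using (DecidableEquality)
open import Relation.Binary.PropositionalEquality
  using (_≡_; _≢_; refl; subst)
open import Relation.Binary.Structures using (IsDecTotalOrder)
open import Relation.Nullary using (¬_; Dec; yes; no)
open import Relation.Nullary.Decidable
  using (_×-dec_; _→-dec_; ¬?; decidable-stable; map′)
open import Relation.Unary using (Pred; Decidable; _∩_)

------------------------------------------------------------------------
-- Finite simplicial complexes

-- The empty set is not counted as a face.  `Fin n` is only an ambient set
-- of labels: a label v is a vertex of K when ⁅ v ⁆ is a face, so that all
-- subcomplexes of K live over the same labels.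
record Complex (n : ℕ) : Set₁ where
  field
    Face        : Pred (Subset n) 0ℓ
    face?       : Decidable Face
    nonempty    : ∀ {σ} → Face σ → Nonempty σ
    down-closed : ∀ {σ τ} → Face σ → τ ⊆ σ → Nonempty τ → Face τ

open Complex public

private
  variable
    n : ℕ

  _≟_ : DecidableEquality (Subset n)
  _≟_ = Vec.≡-dec _≟ᵇ_

  allSubset? : {P : Pred (Subset n) 0ℓ} → Decidable P → Dec (∀ {σ} → P σ)
  allSubset? P? with anySubset? (¬? ∘ P?)
  ... | yes (σ , ¬p) = no (λ all → ¬p (all {σ}))
  ... | no ¬∃        = yes (λ {σ} → decidable-stable (P? σ) (λ ¬p → ¬∃ (σ , ¬p)))

  unique? : {P : Pred (Subset n) 0ℓ} → Decidable P → Dec (∃! _≡_ P)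
  unique? P? =
    anySubset? λ σ → P? σ ×-dec allSubset? (λ τ → P? τ →-dec (σ ≟ τ))

_≐_ : Rel (Complex n) 0ℓ
K ≐ L = ∀ σ → Face K σ ⇔ Face L σ

-- dim σ = ∣ σ ∣ - 1.
FaceOfDim : Complex n → ℕ → Pred (Subset n) 0ℓ
FaceOfDim K d σ = Face K σ × ∣ σ ∣ ≡ ℕ.suc d

Facet : Complex n → Pred (Subset n) 0ℓ
Facet K σ = Face K σ × (∀ {τ} → Face K τ → σ ⊆ τ → τ ≡ σ)

point : Fin n → Complex n
point v = record
  { Face        = _≡ ⁅ v ⁆
  ; face?       = _≟ ⁅ v ⁆
  ; nonempty    = λ { refl → v , x∈⁅x⁆ v }
  ; down-closed = λ { refl τ⊆v (x , x∈τ) →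
      ⊆-antisym τ⊆v λ y∈v →
        subst (_∈ _) (x≡y (x∈⁅y⁆⇒x≡y v (τ⊆v x∈τ)) (x∈⁅y⁆⇒x≡y v y∈v)) x∈τ }
  }
  where
  x≡y : {x y : Fin _} → x ≡ v → y ≡ v → x ≡ y
  x≡y refl refl = refl

-- Only σ itself is removed; its proper faces stay.
_∖_ : (K : Complex n) → Σ (Subset n) (Facet K) → Complex n
K ∖ (σ , _ , maximal) = record
  { Face        = λ τ → Face K τ × τ ≢ σ
  ; face?       = λ τ → face? K τ ×-dec ¬? (τ ≟ σ)
  ; nonempty    = nonempty K ∘ proj₁
  ; down-closed = λ { (Kτ , τ≢σ) ρ⊆τ ρ≠∅ →
      down-closed K Kτ ρ⊆τ ρ≠∅ , λ { refl → τ≢σ (maximal Kτ ρ⊆τ) } }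
  }

-- The d-faces of a (d+1)-dimensional K lying in exactly one (d+1)-face.
BoundaryFacet : Complex n → ℕ → Pred (Subset n) 0ℓ
BoundaryFacet K d σ =
  FaceOfDim K d σ × ∃! _≡_ (FaceOfDim K (ℕ.suc d) ∩ (σ ⊆_))

-- The boundary of a (d+1)-dimensional triangulated manifold, that is, the
-- smallest subcomplex containing the faces above.
∂ : ℕ → Complex n → Complex n
∂ d K = record
  { Face        = λ τ → Nonempty τ × ∃[ σ ] BoundaryFacet K d σ × τ ⊆ σ
  ; face?       = λ τ → nonempty? τ ×-dec
                        anySubset? (λ σ → boundaryFacet? σ ×-dec (τ ⊆? σ))
  ; nonempty    = proj₁
  ; down-closed = λ { (_ , σ , bσ , τ⊆σ) ρ⊆τ ρ≠∅ →
                      ρ≠∅ , σ , bσ , ⊆-trans ρ⊆τ τ⊆σ }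
  }
  where
  faceOfDim? : ∀ e → Decidable (FaceOfDim K e)
  faceOfDim? e σ = face? K σ ×-dec (∣ σ ∣ ℕ.≟ ℕ.suc e)

  boundaryFacet? : Decidable (BoundaryFacet K d)
  boundaryFacet? σ =
    faceOfDim? d σ ×-dec
    unique? (λ τ → faceOfDim? (ℕ.suc d) τ ×-dec (σ ⊆? τ))

------------------------------------------------------------------------
-- Collapses

infix 4 _↘ᵉ_ _↘_

_↘ᵉ_ : Rel (Complex n) 0ℓ
K ↘ᵉ L = ∃[ σ ] ∃[ τ ]
    Face K σ × Face K τ × ∣ τ ∣ ≡ ℕ.suc ∣ σ ∣ × σ ⊂ τ
  × (∀ {ρ} → Face K ρ → σ ⊂ ρ → ρ ≡ τ)
  × (∀ ρ → Face L ρ ⇔ (Face K ρ × ρ ≢ σ × ρ ≢ τ))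

-- The final ≐ is needed because complexes with the same faces need not be
-- propositionally equal.
_↘_ : Rel (Complex n) (suc 0ℓ)
K ↘ L = ∃[ M ] Star _↘ᵉ_ K M × M ≐ L

Collapsible : Complex n → Set₁
Collapsible K = ∃[ v ] K ↘ point v

------------------------------------------------------------------------
-- The real numbers

-- The real numbers are the complete ordered field, which is unique up to
-- isomorphism.  They are characterised by the classical axioms (decidable
-- total order, least upper bounds); building a model takes a classical
-- principle such as excluded middle.
record Reals : Set₁ where
  field
    commutativeRing : CommutativeRing 0ℓ 0ℓ

  open CommutativeRing commutativeRing public
    hiding (refl; sym; trans)

  infix 4 _≤_
  field
    _≤_             : Rel Carrier 0ℓ
    isDecTotalOrder : IsDecTotalOrder _≈_ _≤_
    0≉1             : ¬ (0# ≈ 1#)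
    inverse         : ∀ x → ¬ (x ≈ 0#) → ∃[ y ] (x * y) ≈ 1#
    +-monoˡ-≤       : ∀ {x y} z → x ≤ y → (x + z) ≤ (y + z)
    *-nonneg        : ∀ {x y} → 0# ≤ x → 0# ≤ y → 0# ≤ (x * y)

  UpperBound : Pred Carrier 0ℓ → Pred Carrier 0ℓ
  UpperBound P b = ∀ {x} → P x → x ≤ b

  field
    supremum : (P : Pred Carrier 0ℓ) → ∃ P → ∃ (UpperBound P) →
               ∃[ s ] UpperBound P s × (∀ {b} → UpperBound P b → s ≤ b)

  open NonStrictToStrict _≈_ _≤_ public using (_<_)
  open SemiringSum (CommutativeRing.semiring commutativeRing) public using (sum)
  open VectorEquality (CommutativeRing.setoid commutativeRing) public
    using (≋-setoid)

------------------------------------------------------------------------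
-- Subspaces of Euclidean spaces

module Topology (ℝ : Reals) where
  open Reals ℝ

  ℝ^_ : ℕ → Set
  ℝ^ m = Vector Carrier m

  Region : ℕ → Set₁
  Region m = Pred (ℝ^ m) 0ℓ

  subspace : ∀ {m} → Region m → Setoid 0ℓ 0ℓ
  subspace {m} X = On.setoid {B = ∃ X} (≋-setoid m) proj₁

  -- Each coordinate of x - y has absolute value less than ε.
  Near : ∀ {m} → Carrier → Rel (ℝ^ m) 0ℓ
  Near ε x y = ∀ i → (- ε) < (x i - y i) × (x i - y i) < ε

  Continuous : ∀ {m k} {X : Region m} {Y : Region k} → (∃ X → ∃ Y) → Set
  Continuous f = ∀ x ε → 0# < ε → ∃[ δ ] 0# < δ ×
    (∀ y → Near δ (proj₁ x) (proj₁ y) → Near ε (proj₁ (f x)) (proj₁ (f y)))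

  record Homeomorphism {m k} (X : Region m) (Y : Region k) : Set where
    field
      bijection       : Inverse (subspace X) (subspace Y)
      to-continuous   : Continuous (Inverse.to bijection)
      from-continuous : Continuous (Inverse.from bijection)

  Ball : ∀ d → Region d
  Ball d x = sum (λ i → x i * x i) ≤ 1#

  -- The underlying space, in barycentric coordinates: label v is placed at
  -- the v-th standard basis vector of ℝ^ n.
  Realization : ∀ {n} → Complex n → Region n
  Realization K x =
      (∀ v → 0# ≤ x v)
    × sum x ≈ 1#
    × ∃[ σ ] Face K σ × (∀ v → v ∉ σ → x v ≈ 0#)

-- Faces of K do not depend on ℝ; since ℝ is unique up to isomorphism, the
-- quantifier ranges over presentations of a single field.
SimplicialBall : ℕ → Complex n → Set₁
SimplicialBall d K = (ℝ : Reals) → Homeomorphism ℝ (Realization ℝ K) (Ball ℝ d)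
  where open Topology

-- The ball B has 12 vertices and 36 tetrahedra and no interior vertex, and no triangle of B has
-- exactly one interior edge.  Reading a collapse of B onto ∂B - σ backwards, the first expansion
-- adding an interior edge e would add it either with a triangle whose other two edges are
-- already present, hence in ∂B, or with an end point of e that is not in ∂B; both are excluded.
-- B is the complement of the star of a vertex in a 13-vertex 3-sphere in which three edges form
-- a trefoil, so that it has a knotted spanning edge (the edge 7 8).
--
-- That B is a ball is shown by 164 subdivisions of edges and inverse subdivisions (welds) that
-- transform it into a tetrahedron, each inducing an explicit homeomorphism.  The tetrahedron
-- and the Euclidean ball are unit balls N ≤ 1 and M ≤ 1 of positively homogeneous functions,
-- and x ↦ x / (1 - N x + M x) maps the first homeomorphically onto the second.

module Submission where

open import Defs
open import Data.Nat using (ℕ)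
open import Data.Fin.Subset using (Subset)
open import Data.Product using (Σ; _×_; _,_)
open import Relation.Nullary using (¬_)

open import Level using (0ℓ)
open import Algebra.Bundles using (CommutativeRing)
open import Algebra.Bundles.Raw using (RawRing)
import Algebra.Properties.Ring as RingProperties
import Algebra.Properties.Semiring.Mult.TCOptimised as Mult
import Algebra.Properties.Semiring.Sum as SemiringSum
import Algebra.Solver.Ring as RingSolver
open import Algebra.Solver.Ring.AlmostCommutativeRing
  using (fromCommutativeRing; _-Raw-AlmostCommutative⟶_)
open import Data.Bool.Properties using () renaming (_≟_ to _≟ᵇ_)
open import Data.Fin.Base using (Fin; suc)
open import Data.Fin.Patterns using (0F; 1F; 2F; 3F)
import Data.Fin.Properties as Fin
open import Data.Fin.Subset
  using (inside; outside; _∈_; _∉_; _⊆_; _⊂_; ⊥; Nonempty; ∣_∣; ⁅_⁆)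
open import Data.Fin.Subset.Properties
  using ( _∈?_; _⊆?_; _⊂?_; nonempty?; ∉⊥; ∣⊥∣≡0; Empty-unique; ⊆-refl; ⊆-trans; ⊂-irref
        ; drop-∷-⊆; p⊆q⇒∣p∣≤∣q∣ )
open import Data.Integer.Base as ℤ using (ℤ; +_; -[1+_]; _⊖_)
import Data.Integer.Properties as ℤ
open import Data.List.Base
  using (List; []; _∷_; [_]; _++_; concatMap; filter; foldr; map)
import Data.List.Membership.DecPropositional as DecMembership
import Data.List.Membership.Propositional as List
open import Data.List.Membership.Propositional.Properties
  using (∈-concatMap⁺; ∈-concatMap⁻; ∈-map⁺; ∈-++⁺ˡ; ∈-++⁺ʳ; ∈-filter⁺; ∈-filter⁻)
open import Data.List.Relation.Unary.All as All using (All; all?)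
open import Data.List.Relation.Unary.Any as Any using (Any; any?)
open import Data.Maybe.Base using (just; nothing)
open import Data.Nat.Base as ℕ using ()
open import Data.Nat.DivMod using (_mod_)
import Data.Nat.Properties as ℕ
open import Data.Product using (∃-syntax; proj₁; proj₂)
open import Data.Sum.Base using (_⊎_; inj₁; inj₂; [_,_]′)
open import Data.Vec.Base using ([]; _∷_; here; there; _[_]≔_)
open import Data.Vec.Properties
  using (lookup∘update; lookup∘update′; lookup⇒[]=; []=⇒lookup; ≡-dec)
open import Function.Base using (_∘_; _$_)
open import Function.Bundles using (_⇔_; mk⇔; Equivalence)
open import Relation.Binary.Construct.Closure.ReflexiveTransitive as Star using (Star; _◅_)
import Relation.Binary.Construct.NonStrictToStrict as NonStrictToStrict
open import Relation.Binary.Definitions using (DecidableEquality; WeaklyDecidable)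
open import Relation.Binary.PropositionalEquality
  using (_≡_; _≢_; refl; sym; trans; cong; subst)
import Relation.Binary.Reasoning.Setoid as SetoidReasoning
open import Relation.Binary.Structures using (IsDecTotalOrder)
open import Relation.Nullary using (Dec; yes; no; contradiction)
open import Relation.Nullary.Decidable
  using (_×-dec_; _⊎-dec_; _→-dec_; ¬?; map′; True; toWitness; from-yes)
open import Relation.Unary using (Pred; Decidable)

-- The complex ∂B - σ has the same vertices and edges for every σ: it contains both end points of
-- each interior edge and no interior edge. One finite check on incidences therefore excludes all
-- targets at once. The ball property is of another kind, since a combinatorial certificate has to
-- become a homeomorphism over every model of the reals. Restricting the moves to edges keeps this
-- short: with the new vertex sent to the midpoint of the edge, both directions are translations
-- along one fixed vector, by an amount that is half a coordinate or a maximum of two. A weld is the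
-- same homeomorphism read backwards, and flips and deletions of boundary vertices are composed of
-- these moves. The chain is checked without real numbers; only its interpretation depends on the
-- field. For the last step, rescaling by the quotient N x / M x would need a separate argument at
-- the origin, where it is undefined. The denominator 1 - N x + M x is positive on the whole ball N
-- ≤ 1.

private variable
  n : ℕ

-- Integer coefficients for the ring solver

module IntegerCoefficients {c ℓ} (R : CommutativeRing c ℓ) where
  open CommutativeRing R renaming (refl to ≈-refl; sym to ≈-sym; trans to ≈-trans)
  open Mult semiring renaming (_×_ to _×ᵣ_)
  open RingProperties ring
  open SetoidReasoning setoid

  -- The solver cancels terms by comparing coefficients, which must evaluate. In an abstract ring
  -- this is possible for the images of integers.
  fromℤ : ℤ → Carrier
  fromℤ (+ n)    = n ×ᵣ 1#
  fromℤ -[1+ n ] = - (ℕ.suc n ×ᵣ 1#)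

  fromℤ-neg : ∀ i → fromℤ (ℤ.- i) ≈ - fromℤ i
  fromℤ-neg (+ ℕ.zero)  = ≈-sym -0#≈0#
  fromℤ-neg (+ ℕ.suc n) = ≈-refl
  fromℤ-neg -[1+ n ]    = ≈-sym (-‿involutive _)

  fromℤ-⊖ : ∀ m n → fromℤ (m ⊖ n) ≈ m ×ᵣ 1# - n ×ᵣ 1#
  fromℤ-⊖ m ℕ.zero = ≈-sym (≈-trans (+-congˡ -0#≈0#) (+-identityʳ _))
  fromℤ-⊖ ℕ.zero (ℕ.suc n) = ≈-sym (+-identityˡ _)
  fromℤ-⊖ (ℕ.suc m) (ℕ.suc n) = begin
    fromℤ (ℕ.suc m ⊖ ℕ.suc n)          ≡⟨ cong fromℤ (ℤ.[1+m]⊖[1+n]≡m⊖n m n) ⟩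
    fromℤ (m ⊖ n)                      ≈⟨ fromℤ-⊖ m n ⟩
    a - b                              ≈⟨ +-congʳ (xyx⁻¹≈y 1# a) ⟨
    1# + a - 1# - b                    ≈⟨ +-assoc _ _ _ ⟩
    1# + a + (- 1# - b)                ≈⟨ +-congˡ (-‿+-comm 1# b) ⟩
    (1# + a) - (1# + b)                ≈⟨ +-cong (1+× m 1#) (-‿cong (1+× n 1#)) ⟨
    ℕ.suc m ×ᵣ 1# - ℕ.suc n ×ᵣ 1#        ∎
    where a = m ×ᵣ 1# ; b = n ×ᵣ 1#

  fromℤ-+ : ∀ i j → fromℤ (i ℤ.+ j) ≈ fromℤ i + fromℤ j
  fromℤ-+ (+ m) (+ n) = ×-homo-+ 1# m n
  fromℤ-+ (+ m) -[1+ n ] = fromℤ-⊖ m (ℕ.suc n)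
  fromℤ-+ -[1+ m ] (+ n) = ≈-trans (fromℤ-⊖ n (ℕ.suc m)) (+-comm _ _)
  fromℤ-+ -[1+ m ] -[1+ n ] = begin
    fromℤ (-[1+ m ] ℤ.+ -[1+ n ])            ≡⟨ cong fromℤ (ℤ.neg-distrib-+ (+ ℕ.suc m) (+ ℕ.suc n)) ⟨
    - ((ℕ.suc m ℕ.+ ℕ.suc n) ×ᵣ 1#)           ≈⟨ -‿cong (×-homo-+ 1# (ℕ.suc m) (ℕ.suc n)) ⟩
    - (ℕ.suc m ×ᵣ 1# + ℕ.suc n ×ᵣ 1#)          ≈⟨ -‿+-comm _ _ ⟨
    fromℤ -[1+ m ] + fromℤ -[1+ n ]          ∎

  fromℤ-pos-* : ∀ m j → fromℤ (+ m ℤ.* j) ≈ m ×ᵣ 1# * fromℤ j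
  fromℤ-pos-* m (+ n) = begin
    fromℤ (+ m ℤ.* + n)  ≡⟨ cong fromℤ (ℤ.pos-* m n) ⟨
    (m ℕ.* n) ×ᵣ 1#       ≈⟨ ×1-homo-* m n ⟩
    m ×ᵣ 1# * n ×ᵣ 1#      ∎
  fromℤ-pos-* m -[1+ n ] = begin
    fromℤ (+ m ℤ.* -[1+ n ])           ≡⟨ cong fromℤ (ℤ.neg-distribʳ-* (+ m) (+ ℕ.suc n)) ⟨
    fromℤ (ℤ.- (+ m ℤ.* + ℕ.suc n))    ≈⟨ fromℤ-neg (+ m ℤ.* + ℕ.suc n) ⟩
    - fromℤ (+ m ℤ.* + ℕ.suc n)        ≈⟨ -‿cong (fromℤ-pos-* m (+ ℕ.suc n)) ⟩
    - (m ×ᵣ 1# * ℕ.suc n ×ᵣ 1#)          ≈⟨ -‿distribʳ-* _ _ ⟩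
    m ×ᵣ 1# * fromℤ -[1+ n ]            ∎

  fromℤ-* : ∀ i j → fromℤ (i ℤ.* j) ≈ fromℤ i * fromℤ j
  fromℤ-* (+ m) j = fromℤ-pos-* m j
  fromℤ-* -[1+ m ] j = begin
    fromℤ (-[1+ m ] ℤ.* j)             ≡⟨ cong fromℤ (ℤ.neg-distribˡ-* (+ ℕ.suc m) j) ⟨
    fromℤ (ℤ.- (+ ℕ.suc m ℤ.* j))      ≈⟨ fromℤ-neg (+ ℕ.suc m ℤ.* j) ⟩
    - fromℤ (+ ℕ.suc m ℤ.* j)          ≈⟨ -‿cong (fromℤ-pos-* (ℕ.suc m) j) ⟩
    - (ℕ.suc m ×ᵣ 1# * fromℤ j)         ≈⟨ -‿distribˡ-* _ _ ⟩
    fromℤ -[1+ m ] * fromℤ j           ∎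

  private
    ℤ-rawRing : RawRing 0ℓ 0ℓ
    ℤ-rawRing = record
      { _≈_ = _≡_ ; _+_ = ℤ._+_ ; _*_ = ℤ._*_ ; -_ = ℤ.-_ ; 0# = ℤ.0ℤ ; 1# = ℤ.1ℤ }

    morphism : ℤ-rawRing -Raw-AlmostCommutative⟶ fromCommutativeRing R
    morphism = record
      { ⟦_⟧ = fromℤ ; +-homo = fromℤ-+ ; *-homo = fromℤ-* ; -‿homo = fromℤ-neg
      ; 0-homo = ≈-refl ; 1-homo = ≈-refl }

    coefficient≟ : WeaklyDecidable (λ i j → fromℤ i ≈ fromℤ j)
    coefficient≟ i j with i ℤ.≟ j
    ... | yes refl = just (≈-refl)
    ... | no _     = nothing

  open RingSolver ℤ-rawRing (fromCommutativeRing R) morphism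
    coefficient≟ public
    using (solve; con; _:=_; _:+_; _:*_; _:-_; :-_; Polynomial)

-- Arithmetic in an ordered field

module OrderedField (ℝ : Reals) where
  open Reals ℝ
  open CommutativeRing commutativeRing public
    using () renaming (refl to ≈-refl; sym to ≈-sym; trans to ≈-trans)
  open RingProperties ring public using (-0#≈0#)
  open IsDecTotalOrder isDecTotalOrder public
    using (≤-respˡ-≈; ≤-respʳ-≈; antisym; total; _≟_; _≤?_)
    renaming (refl to ≤-refl; reflexive to ≤-reflexive; trans to ≤-trans)
  open IntegerCoefficients commutativeRing public
    using (solve; con; _:=_; _:+_; _:*_; _:-_; :-_)
  private
    module Strict = NonStrictToStrict _≈_ _≤_

  <-≤-trans : ∀ {x y z} → x < y → y ≤ z → x < z
  <-≤-trans = Strict.<-≤-trans ≈-sym ≤-trans antisym ≤-respʳ-≈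

  ≤-<-trans : ∀ {x y z} → x ≤ y → y < z → x < z
  ≤-<-trans = Strict.≤-<-trans ≤-trans antisym ≤-respˡ-≈

  <⇒≱ : ∀ {x y} → x < y → ¬ (y ≤ x)
  <⇒≱ = Strict.<⇒≱ antisym

  ≰⇒> : ∀ {x y} → ¬ (x ≤ y) → y < x
  ≰⇒> = Strict.≰⇒> ≈-sym ≤-reflexive total

  <-respʳ-≈ : ∀ {x y z} → y ≈ z → x < y → x < z
  <-respʳ-≈ = Strict.<-respʳ-≈ ≈-sym ≈-trans ≤-respʳ-≈

  <-respˡ-≈ : ∀ {x y z} → y ≈ z → y < x → z < x
  <-respˡ-≈ = Strict.<-respˡ-≈ ≈-trans ≤-respˡ-≈

  x≤y⇒0≤y-x : ∀ {x y} → x ≤ y → 0# ≤ y - x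
  x≤y⇒0≤y-x {x} x≤y = ≤-respˡ-≈ (-‿inverseʳ x) (+-monoˡ-≤ (- x) x≤y)

  -- The standard form of later estimates: the difference of the two sides is written as an
  -- expression `d` that is visibly nonnegative, and the identity is left to the solver.
  ≤-from : ∀ {x y d} → 0# ≤ d → d ≈ y - x → x ≤ y
  ≤-from {x} {y} 0≤d d≈ =
    ≤-respˡ-≈ (+-identityˡ x)
      (≤-respʳ-≈ (solve 2 (λ x y → y :- x :+ x := y) ≈-refl x y)
        (+-monoˡ-≤ x (≤-respʳ-≈ d≈ 0≤d)))

  x<y⇒0<y-x : ∀ {x y} → x < y → 0# < y - x
  x<y⇒0<y-x {x} {y} (x≤y , x≉y) = x≤y⇒0≤y-x x≤y , λ 0≈ → x≉y $
    ≈-trans (≈-sym (+-identityˡ x)) $ ≈-trans (+-congʳ 0≈) $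
    solve 2 (λ x y → y :- x :+ x := y) ≈-refl x y

  <-from : ∀ {x y d} → 0# < d → d ≈ y - x → x < y
  <-from {x} {y} (0≤d , 0≉d) d≈ = ≤-from 0≤d d≈ , λ x≈y → 0≉d $
    ≈-sym $ ≈-trans d≈ $ ≈-trans (+-congˡ (-‿cong x≈y)) (-‿inverseʳ y)

  +-nonneg : ∀ {x y} → 0# ≤ x → 0# ≤ y → 0# ≤ x + y
  +-nonneg {x} {y} 0≤x 0≤y =
    ≤-trans 0≤y (≤-respˡ-≈ (+-identityˡ y) (+-monoˡ-≤ y 0≤x))

  x≤x+y : ∀ {x y} → 0# ≤ y → x ≤ x + y
  x≤x+y {x} {y} 0≤y = ≤-from 0≤y (solve 2 (λ x y → y := x :+ y :- x) ≈-refl x y)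

  x<x+y : ∀ {x y} → 0# < y → x < x + y
  x<x+y {x} {y} 0<y = <-from 0<y (solve 2 (λ x y → y := x :+ y :- x) ≈-refl x y)

  +-pos-nonneg : ∀ {x y} → 0# < x → 0# ≤ y → 0# < x + y
  +-pos-nonneg 0<x 0≤y = <-≤-trans 0<x (x≤x+y 0≤y)

  +-nonneg-pos : ∀ {x y} → 0# ≤ x → 0# < y → 0# < x + y
  +-nonneg-pos {x} {y} 0≤x 0<y = <-respʳ-≈ (+-comm y x) (+-pos-nonneg 0<y 0≤x)

  +-nonneg≈0 : ∀ {x y} → 0# ≤ x → 0# ≤ y → x + y ≈ 0# → x ≈ 0# × y ≈ 0#
  +-nonneg≈0 {x} {y} 0≤x 0≤y x+y≈0 =
    antisym (≤-respʳ-≈ x+y≈0 (x≤x+y 0≤y)) 0≤x ,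
    antisym (≤-respʳ-≈ (≈-trans (+-comm y x) x+y≈0) (x≤x+y 0≤x)) 0≤y

  +-mono-≤ : ∀ {x y u v} → x ≤ y → u ≤ v → x + u ≤ y + v
  +-mono-≤ {x} {y} {u} {v} x≤y u≤v =
    ≤-from (+-nonneg (x≤y⇒0≤y-x x≤y) (x≤y⇒0≤y-x u≤v))
      (solve 4 (λ x y u v → (y :- x) :+ (v :- u) := y :+ v :- (x :+ u)) ≈-refl x y u v)

  +-mono-< : ∀ {x y u v} → x < y → u ≤ v → x + u < y + v
  +-mono-< {x} {y} {u} {v} x<y u≤v =
    <-from (+-pos-nonneg (x<y⇒0<y-x x<y) (x≤y⇒0≤y-x u≤v))
      (solve 4 (λ x y u v → (y :- x) :+ (v :- u) := y :+ v :- (x :+ u)) ≈-refl x y u v)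

  neg-mono-≤ : ∀ {x y} → x ≤ y → - y ≤ - x
  neg-mono-≤ {x} {y} x≤y =
    ≤-from (x≤y⇒0≤y-x x≤y) (solve 2 (λ x y → y :- x := :- x :- :- y) ≈-refl x y)

  neg-mono-< : ∀ {x y} → x < y → - y < - x
  neg-mono-< {x} {y} x<y =
    <-from (x<y⇒0<y-x x<y) (solve 2 (λ x y → y :- x := :- x :- :- y) ≈-refl x y)

  square-nonneg : ∀ x → 0# ≤ x * x
  square-nonneg x with total 0# x
  ... | inj₁ 0≤x = *-nonneg 0≤x 0≤x
  ... | inj₂ x≤0 = ≤-respʳ-≈ (solve 1 (λ x → :- x :* :- x := x :* x) ≈-refl x) (*-nonneg 0≤-x 0≤-x)
    where
    0≤-x : 0# ≤ - x
    0≤-x = ≤-respˡ-≈ -0#≈0# (neg-mono-≤ x≤0)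

  0<1 : 0# < 1#
  0<1 = ≤-respʳ-≈ (*-identityʳ 1#) (square-nonneg 1#) , 0≉1

  0≤1 : 0# ≤ 1#
  0≤1 = proj₁ 0<1

  *-monoˡ-≤ : ∀ {x y z} → 0# ≤ z → x ≤ y → z * x ≤ z * y
  *-monoˡ-≤ {x} {y} {z} 0≤z x≤y =
    ≤-from (*-nonneg 0≤z (x≤y⇒0≤y-x x≤y))
      (solve 3 (λ x y z → z :* (y :- x) := z :* y :- z :* x) ≈-refl x y z)

  infix 8 _⁻¹

  -- Made total by the value 0 at 0, so that formulas with a quotient define maps on the whole
  -- ambient space.
  _⁻¹ : Carrier → Carrier
  x ⁻¹ with x ≟ 0#
  ... | yes _  = 0#
  ... | no x≉0 = proj₁ (inverse x x≉0)

  x*x⁻¹≈1 : ∀ {x} → ¬ (x ≈ 0#) → x * x ⁻¹ ≈ 1#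
  x*x⁻¹≈1 {x} x≉0 with x ≟ 0#
  ... | yes x≈0 = contradiction x≈0 x≉0
  ... | no x≉0′ = proj₂ (inverse x x≉0′)

  pos-inverse : ∀ {x} → 0# < x → x * x ⁻¹ ≈ 1#
  pos-inverse (_ , 0≉x) = x*x⁻¹≈1 (0≉x ∘ ≈-sym)

  x*y≈0⇒y≈0 : ∀ {x y} → ¬ (x ≈ 0#) → x * y ≈ 0# → y ≈ 0#
  x*y≈0⇒y≈0 {x} {y} x≉0 xy≈0 =
    ≈-trans (≈-sym (*-identityˡ y)) $ ≈-trans (*-congʳ (≈-sym (x*x⁻¹≈1 x≉0))) $
    ≈-trans (solve 3 (λ x y z → x :* z :* y := z :* (x :* y)) ≈-refl x y (x ⁻¹)) $
    ≈-trans (*-congˡ xy≈0) (zeroʳ _)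

  *-pos : ∀ {x y} → 0# < x → 0# < y → 0# < x * y
  *-pos (0≤x , 0≉x) (0≤y , 0≉y) =
    *-nonneg 0≤x 0≤y , λ 0≈xy → 0≉y (≈-sym (x*y≈0⇒y≈0 (0≉x ∘ ≈-sym) (≈-sym 0≈xy)))

  square≈0 : ∀ {x} → x * x ≈ 0# → x ≈ 0#
  square≈0 {x} xx≈0 with x ≟ 0#
  ... | yes x≈0 = x≈0
  ... | no x≉0  = x*y≈0⇒y≈0 x≉0 xx≈0

  ⁻¹-pos : ∀ {x} → 0# < x → 0# < x ⁻¹
  ⁻¹-pos {x} 0<x = ≰⇒> λ x⁻¹≤0 → <⇒≱ 0<1 $
    ≤-respˡ-≈ (pos-inverse 0<x) (≤-respʳ-≈ (zeroʳ x) (*-monoˡ-≤ (proj₁ 0<x) x⁻¹≤0))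

  *-monoˡ-< : ∀ {x y z} → 0# < z → x < y → z * x < z * y
  *-monoˡ-< {x} {y} {z} 0<z x<y =
    <-from (*-pos 0<z (x<y⇒0<y-x x<y))
      (solve 3 (λ x y z → z :* (y :- x) := z :* y :- z :* x) ≈-refl x y z)

  *-cancelˡ-≤ : ∀ {x y z} → 0# < z → z * x ≤ z * y → x ≤ y
  *-cancelˡ-≤ {x} {y} 0<z zx≤zy with x ≤? y
  ... | yes x≤y = x≤y
  ... | no x≰y  = contradiction zx≤zy (<⇒≱ (*-monoˡ-< 0<z (≰⇒> x≰y)))

  ½ : Carrier
  ½ = (1# + 1#) ⁻¹

  0<2 : 0# < 1# + 1#
  0<2 = +-pos-nonneg 0<1 0≤1

  0<½ : 0# < ½
  0<½ = ⁻¹-pos 0<2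

  ½x+½x : ∀ x → ½ * x + ½ * x ≈ x
  ½x+½x x = ≈-trans (solve 2 (λ x h → h :* x :+ h :* x := (con (+ 1) :+ con (+ 1)) :* h :* x) ≈-refl x ½) $
    ≈-trans (*-congʳ (pos-inverse 0<2)) (*-identityˡ x)

  0≤x+x⇒0≤x : ∀ {x} → 0# ≤ x + x → 0# ≤ x
  0≤x+x⇒0≤x {x} 0≤ = ≤-respʳ-≈
    (≈-trans (solve 2 (λ x h → h :* (x :+ x) := h :* x :+ h :* x) ≈-refl x ½) (½x+½x x))
    (*-nonneg (proj₁ 0<½) 0≤)

  infixl 6 _⊔_ _⊓_

  _⊔_ : Carrier → Carrier → Carrier
  x ⊔ y with total x y
  ... | inj₁ _ = y
  ... | inj₂ _ = x

  x≤x⊔y : ∀ x y → x ≤ x ⊔ y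
  x≤x⊔y x y with total x y
  ... | inj₁ x≤y = x≤y
  ... | inj₂ _   = ≤-refl

  y≤x⊔y : ∀ x y → y ≤ x ⊔ y
  y≤x⊔y x y with total x y
  ... | inj₁ _   = ≤-refl
  ... | inj₂ y≤x = y≤x

  ⊔-sel : ∀ x y → x ⊔ y ≈ x ⊎ x ⊔ y ≈ y
  ⊔-sel x y with total x y
  ... | inj₁ _ = inj₂ ≈-refl
  ... | inj₂ _ = inj₁ ≈-refl

  ⊔-lub : ∀ {x y z} → x ≤ z → y ≤ z → x ⊔ y ≤ z
  ⊔-lub {x} {y} x≤z y≤z with ⊔-sel x y
  ... | inj₁ ≈x = ≤-respˡ-≈ (≈-sym ≈x) x≤z
  ... | inj₂ ≈y = ≤-respˡ-≈ (≈-sym ≈y) y≤z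

  ⊔-cong : ∀ {x y u v} → x ≈ u → y ≈ v → x ⊔ y ≈ u ⊔ v
  ⊔-cong {x} {y} {u} {v} x≈u y≈v = antisym
    (⊔-lub (≤-respˡ-≈ (≈-sym x≈u) (x≤x⊔y u v)) (≤-respˡ-≈ (≈-sym y≈v) (y≤x⊔y u v)))
    (⊔-lub (≤-respˡ-≈ x≈u (x≤x⊔y x y)) (≤-respˡ-≈ y≈v (y≤x⊔y x y)))

  *-distribˡ-⊔ : ∀ {z} x y → 0# ≤ z → z * x ⊔ z * y ≈ z * (x ⊔ y)
  *-distribˡ-⊔ {z} x y 0≤z = antisym
    (⊔-lub (*-monoˡ-≤ 0≤z (x≤x⊔y x y)) (*-monoˡ-≤ 0≤z (y≤x⊔y x y)))
    (below (⊔-sel x y))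
    where
    below : x ⊔ y ≈ x ⊎ x ⊔ y ≈ y → z * (x ⊔ y) ≤ z * x ⊔ z * y
    below (inj₁ ≈x) = ≤-respˡ-≈ (*-congˡ (≈-sym ≈x)) (x≤x⊔y _ _)
    below (inj₂ ≈y) = ≤-respˡ-≈ (*-congˡ (≈-sym ≈y)) (y≤x⊔y _ _)

  _⊓_ : Carrier → Carrier → Carrier
  x ⊓ y = - (- x ⊔ - y)

  private
    -≤⇒-≤ : ∀ {x y} → - x ≤ y → - y ≤ x
    -≤⇒-≤ {x} {y} -x≤y = ≤-from (x≤y⇒0≤y-x -x≤y) (solve 2 (λ x y → y :- :- x := x :- :- y) ≈-refl x y)

  x⊓y≤x : ∀ x y → x ⊓ y ≤ x
  x⊓y≤x x y = -≤⇒-≤ (x≤x⊔y (- x) (- y))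

  x⊓y≤y : ∀ x y → x ⊓ y ≤ y
  x⊓y≤y x y = -≤⇒-≤ (y≤x⊔y (- x) (- y))

  ⊓-sel : ∀ x y → x ⊓ y ≈ x ⊎ x ⊓ y ≈ y
  ⊓-sel x y with ⊔-sel (- x) (- y)
  ... | inj₁ ≈-x = inj₁ (≈-trans (-‿cong ≈-x) (solve 1 (λ x → :- :- x := x) ≈-refl x))
  ... | inj₂ ≈-y = inj₂ (≈-trans (-‿cong ≈-y) (solve 1 (λ x → :- :- x := x) ≈-refl y))

  ⊓-pos : ∀ {x y} → 0# < x → 0# < y → 0# < x ⊓ y
  ⊓-pos {x} {y} 0<x 0<y with ⊓-sel x y
  ... | inj₁ ≈x = <-respʳ-≈ (≈-sym ≈x) 0<x
  ... | inj₂ ≈y = <-respʳ-≈ (≈-sym ≈y) 0<y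

-- Continuity of real-valued functions

module Continuity (ℝ : Reals) where
  open Reals ℝ
  open Topology ℝ
  open OrderedField ℝ

  private variable
    m k l : ℕ

  Within : Carrier → Carrier → Set
  Within ε d = - ε < d × d < ε

  Within-resp : ∀ {ε d e} → d ≈ e → Within ε d → Within ε e
  Within-resp d≈e (l , u) = <-respʳ-≈ d≈e l , <-respˡ-≈ d≈e u

  Within-mono : ∀ {δ ε d} → δ ≤ ε → Within δ d → Within ε d
  Within-mono δ≤ε (l , u) = ≤-<-trans (neg-mono-≤ δ≤ε) l , <-≤-trans u δ≤ε

  Within-neg : ∀ {ε d} → Within ε d → Within ε (- d)
  Within-neg {ε} {d} (l , u) =
    neg-mono-< u , <-respʳ-≈ (solve 1 (λ x → :- :- x := x) ≈-refl ε) (neg-mono-< l)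

  Within-swap : ∀ {ε x y} → Within ε (x - y) → Within ε (y - x)
  Within-swap {x = x} {y} =
    Within-resp (solve 2 (λ x y → :- (x :- y) := y :- x) ≈-refl x y) ∘ Within-neg

  Within-+ : ∀ {ε d e} → Within (½ * ε) d → Within (½ * ε) e → Within ε (d + e)
  Within-+ {ε} (ld , ud) (le , ue) =
    <-respˡ-≈ (≈-trans (solve 2 (λ h ε → :- (h :* ε) :+ :- (h :* ε) := :- (h :* ε :+ h :* ε)) ≈-refl ½ ε)
                       (-‿cong (½x+½x ε)))
      (+-mono-< ld (proj₁ le)) ,
    <-respʳ-≈ (½x+½x ε) (+-mono-< ud (proj₁ ue))

  -- For `d` different from 0, taking its absolute value for ε would give a strict inequality
  -- between equal numbers.
  Within-all⇒≈0 : ∀ {d} → (∀ ε → 0# < ε → Within ε d) → d ≈ 0#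
  Within-all⇒≈0 {d} small with total 0# d | d ≟ 0#
  ... | _        | yes d≈0 = d≈0
  ... | inj₁ 0≤d | no d≉0  =
    contradiction ≤-refl (<⇒≱ (proj₂ (small d (0≤d , d≉0 ∘ ≈-sym))))
  ... | inj₂ d≤0 | no d≉0  =
    contradiction (≤-reflexive (solve 1 (λ d → d := :- :- d) ≈-refl d))
      (<⇒≱ (proj₁ (small (- d) (<-respˡ-≈ -0#≈0# (neg-mono-< (d≤0 , d≉0))))))

  ContinuousAt : (ℝ^ m → Carrier) → ℝ^ m → Set
  ContinuousAt f x = ∀ ε → 0# < ε →
    ∃[ δ ] 0# < δ × (∀ y → Near δ x y → Within ε (f x - f y))

  Near-mono : ∀ {δ ε} {x y : ℝ^ m} → δ ≤ ε → Near δ x y → Near ε x y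
  Near-mono δ≤ε near i = Within-mono δ≤ε (near i)

  module _ {x : ℝ^ m} where

    continuous-coordinate : ∀ i → ContinuousAt (λ y → y i) x
    continuous-coordinate i ε 0<ε = ε , 0<ε , λ y near → near i

    continuous-const : ∀ c → ContinuousAt (λ _ → c) x
    continuous-const c ε 0<ε = 1# , 0<1 , λ y _ →
      Within-resp (≈-sym (-‿inverseʳ c)) (<-respʳ-≈ -0#≈0# (neg-mono-< 0<ε) , 0<ε)

    continuous₂ : ∀ {f g} → ContinuousAt f x → ContinuousAt g x → ∀ ε → 0# < ε →
      ∃[ δ ] 0# < δ × (∀ y → Near δ x y → Within ε (f x - f y) × Within ε (g x - g y))
    continuous₂ fc gc ε 0<ε with fc ε 0<ε | gc ε 0<ε
    ... | δ , 0<δ , f-close | δ′ , 0<δ′ , g-close =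
      δ ⊓ δ′ , ⊓-pos 0<δ 0<δ′ , λ y near →
        f-close y (Near-mono (x⊓y≤x δ δ′) near) , g-close y (Near-mono (x⊓y≤y δ δ′) near)

    continuous-+ : ∀ {f g} → ContinuousAt f x → ContinuousAt g x →
                   ContinuousAt (λ y → f y + g y) x
    continuous-+ {f} {g} fc gc ε 0<ε =
      let (δ , 0<δ , close) = continuous₂ fc gc (½ * ε) (*-pos 0<½ 0<ε) in
      δ , 0<δ , λ y near → let (f-close , g-close) = close y near in
      Within-resp (solve 4 (λ a a′ b b′ → a :- a′ :+ (b :- b′) := a :+ b :- (a′ :+ b′)) ≈-refl (f x) (f y) (g x) (g y))
        (Within-+ f-close g-close)

    continuous-neg : ∀ {f} → ContinuousAt f x → ContinuousAt (λ y → - f y) x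
    continuous-neg {f} fc ε 0<ε =
      let (δ , 0<δ , close) = fc ε 0<ε in
      δ , 0<δ , λ y near →
      Within-resp (solve 2 (λ a a′ → :- (a :- a′) := :- a :- :- a′) ≈-refl (f x) (f y)) (Within-neg (close y near))

    private
      -- Whichever of a and b is the maximum is compared with its own counterpart, and that
      -- counterpart is at most a′ ⊔ b′.
      ⊔-close : ∀ {a a′ b b′ ε} → a - a′ < ε → b - b′ < ε → (a ⊔ b) - (a′ ⊔ b′) < ε
      ⊔-close {a} {a′} {b} {b′} a-a′<ε b-b′<ε with ⊔-sel a b
      ... | inj₁ ≈a = ≤-<-trans (+-mono-≤ (≤-reflexive ≈a) (neg-mono-≤ (x≤x⊔y a′ b′))) a-a′<ε
      ... | inj₂ ≈b = ≤-<-trans (+-mono-≤ (≤-reflexive ≈b) (neg-mono-≤ (y≤x⊔y a′ b′))) b-b′<ε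

    continuous-⊔ : ∀ {f g} → ContinuousAt f x → ContinuousAt g x →
                   ContinuousAt (λ y → f y ⊔ g y) x
    continuous-⊔ fc gc ε 0<ε =
      let (δ , 0<δ , close) = continuous₂ fc gc ε 0<ε in
      δ , 0<δ , λ y near → let (f-close , g-close) = close y near in
      proj₁ (Within-swap (Within-both (⊔-close (proj₂ (Within-swap f-close)) (proj₂ (Within-swap g-close)))
                                      (⊔-close (proj₂ f-close) (proj₂ g-close)))) ,
      ⊔-close (proj₂ f-close) (proj₂ g-close)
      where
      Within-both : ∀ {ε a b} → a - b < ε → b - a < ε → Within ε (a - b)
      Within-both {ε} {a} {b} a-b<ε b-a<ε =
        <-respʳ-≈ (solve 2 (λ a b → :- (b :- a) := a :- b) ≈-refl a b) (neg-mono-< b-a<ε) , a-b<ε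

    private
      -- Twice A ε - a u equals (A - a)(u + ε) + (A + a)(ε - u), a sum of products of nonnegative
      -- factors. This avoids a case distinction on signs.
      bounded-* : ∀ {a A u ε} → a ≤ A → - a ≤ A → Within ε u → a * u ≤ A * ε
      bounded-* {a} {A} {u} {ε} a≤A -a≤A (l , h) = ≤-from
        (0≤x+x⇒0≤x (≤-respʳ-≈
          (solve 4 (λ a A u ε → (A :- a) :* (u :- :- ε) :+ (A :- :- a) :* (ε :- u)
                     := (A :* ε :- a :* u) :+ (A :* ε :- a :* u)) ≈-refl a A u ε)
          (+-nonneg (*-nonneg (x≤y⇒0≤y-x a≤A) (x≤y⇒0≤y-x (proj₁ l)))
                    (*-nonneg (x≤y⇒0≤y-x -a≤A) (x≤y⇒0≤y-x (proj₁ h))))))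
        ≈-refl

      -- The difference is a v + b u - u v. Its terms are at most |a| ε, |b| ε and, since ε ≤ 1, ε;
      -- here |a| is written `a ⊔ - a`. One further ε in the bound makes it strict.
      product-upper : ∀ {a b u v ε} → 0# < ε → ε ≤ 1# → Within ε u → Within ε v →
        a * b - (a - u) * (b - v) < (1# + ((a ⊔ - a) + (b ⊔ - b) + 1#)) * ε
      product-upper {a} {b} {u} {v} {ε} 0<ε ε≤1 u-close v-close =
        <-respˡ-≈ (solve 4 (λ a b u v → a :* v :+ b :* u :+ :- u :* v := a :* b :- (a :- u) :* (b :- v)) ≈-refl a b u v)
          (<-respʳ-≈ (solve 3 (λ A B ε → A :* ε :+ B :* ε :+ con (+ 1) :* ε :+ ε
                                           := (con (+ 1) :+ (A :+ B :+ con (+ 1))) :* ε)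
                       ≈-refl (a ⊔ - a) (b ⊔ - b) ε)
            (≤-<-trans (+-mono-≤ (+-mono-≤ av bu) uv)
              (x<x+y 0<ε)))
        where
        av : a * v ≤ (a ⊔ - a) * ε
        av = bounded-* (x≤x⊔y a (- a)) (y≤x⊔y a (- a)) v-close
        bu : b * u ≤ (b ⊔ - b) * ε
        bu = bounded-* (x≤x⊔y b (- b)) (y≤x⊔y b (- b)) u-close
        uv : - u * v ≤ 1# * ε
        uv = bounded-* (≤-trans (proj₁ (proj₂ (Within-neg u-close))) ε≤1)
               (≤-trans (proj₁ (proj₂ (Within-neg (Within-neg u-close)))) ε≤1) v-close

    ∣x∣-nonneg : ∀ a → 0# ≤ a ⊔ - a
    ∣x∣-nonneg a with total 0# a
    ... | inj₁ 0≤a = ≤-trans 0≤a (x≤x⊔y a (- a))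
    ... | inj₂ a≤0 = ≤-trans (≤-respˡ-≈ -0#≈0# (neg-mono-≤ a≤0)) (y≤x⊔y a (- a))

    private
      product-bound : Carrier → Carrier → Carrier
      product-bound a b = 1# + ((a ⊔ - a) + (b ⊔ - b) + 1#)

      product-bound-neg : ∀ a b → product-bound (- a) b ≈ product-bound a b
      product-bound-neg a b = +-congˡ (+-congʳ (+-congʳ (antisym
        (⊔-lub (y≤x⊔y a (- a)) (≤-respˡ-≈ a≈--a (x≤x⊔y a (- a))))
        (⊔-lub (≤-respˡ-≈ (≈-sym a≈--a) (y≤x⊔y (- a) (- - a))) (x≤x⊔y (- a) (- - a))))))
        where
        a≈--a : a ≈ - - a
        a≈--a = solve 1 (λ a → a := :- :- a) ≈-refl a

      -- The lower bound is the upper bound for - a and b, as the constant depends on a only through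
      -- its absolute value.
      product-close : ∀ {a b a′ b′ ε} → 0# < ε → ε ≤ 1# → Within ε (a - a′) → Within ε (b - b′) →
        Within (product-bound a b * ε) (a * b - a′ * b′)
      product-close {a} {b} {a′} {b′} {ε} 0<ε ε≤1 a-close b-close =
        <-respˡ-≈ (-‿cong (*-congʳ (product-bound-neg a b)))
          (<-respʳ-≈ (solve 4 (λ a b a′ b′ → :- (:- a :* b :- (:- a :- :- (a :- a′)) :* (b :- (b :- b′)))
                        := a :* b :- a′ :* b′) ≈-refl a b a′ b′)
            (neg-mono-< (product-upper {a = - a} {b} 0<ε ε≤1 (Within-neg a-close) b-close))) ,
        <-respˡ-≈ (solve 4 (λ a b a′ b′ → a :* b :- (a :- (a :- a′)) :* (b :- (b :- b′))
                      := a :* b :- a′ :* b′) ≈-refl a b a′ b′)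
          (product-upper 0<ε ε≤1 a-close b-close)

    continuous-* : ∀ {f g} → ContinuousAt f x → ContinuousAt g x →
                   ContinuousAt (λ y → f y * g y) x
    continuous-* {f} {g} fc gc ε 0<ε =
      let (δ , 0<δ , close) = continuous₂ fc gc η 0<η in
      δ , 0<δ , λ y near →
        Within-mono Kη≤ε (product-close 0<η (x⊓y≤x 1# _) (proj₁ (close y near)) (proj₂ (close y near)))
      where
      a = f x ; b = g x
      K = product-bound a b
      0<K : 0# < K
      0<K = +-pos-nonneg 0<1 (+-nonneg (+-nonneg (∣x∣-nonneg a) (∣x∣-nonneg b)) 0≤1)
      η = 1# ⊓ (K ⁻¹ * ε)
      0<η : 0# < η
      0<η = ⊓-pos 0<1 (*-pos (⁻¹-pos 0<K) 0<ε)
      Kη≤ε : K * η ≤ ε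
      Kη≤ε = ≤-respʳ-≈ (≈-trans (≈-sym (*-assoc K _ ε)) (≈-trans (*-congʳ (pos-inverse 0<K)) (*-identityˡ ε)))
        (*-monoˡ-≤ (proj₁ 0<K) (x⊓y≤y 1# _))

-- Homeomorphisms given by formulas, and rescaling along rays

module Homeomorphisms (ℝ : Reals) where
  open Reals ℝ
  open Topology ℝ
  open OrderedField ℝ
  open Continuity ℝ

  private variable
    m k l : ℕ

  Within-scale : ∀ {w δ d} → 0# < w → Within δ d → Within (w * δ) (w * d)
  Within-scale {w} {δ} 0<w (l , u) =
    <-respˡ-≈ (solve 2 (λ w δ → w :* :- δ := :- (w :* δ)) ≈-refl w δ) (*-monoˡ-< 0<w l) ,
    *-monoˡ-< 0<w u

  -- The difference of the inverses is (b′ - b) / (b b′). The first bound on b - b′ gives b ≤ 2 b′,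
  -- so that 1 / b′ ≤ 2 / b; the second then makes the quotient at most ε.
  ⁻¹-close : ∀ {b b′ ε} → 0# < b → 0# < ε → Within ((½ * b) ⊓ (½ * (ε * (b * b)))) (b - b′) →
             Within ε (b ⁻¹ - b′ ⁻¹)
  ⁻¹-close {b} {b′} {ε} 0<b 0<ε close =
    Within-resp eq (Within-mono wδ≤ε (Within-scale 0<w (Within-swap close)))
    where
    δ = (½ * b) ⊓ (½ * (ε * (b * b)))
    i = b ⁻¹ ; i′ = b′ ⁻¹ ; w = i * i′

    b≤2b′ : b ≤ b′ + b′
    b≤2b′ = ≤-respˡ-≈ (½x+½x b) (+-mono-≤ ½b≤b′ ½b≤b′)
      where
      ½b≤b′ : ½ * b ≤ b′
      ½b≤b′ = ≤-from (x≤y⇒0≤y-x (proj₁ (proj₂ (Within-mono (x⊓y≤x (½ * b) _) close))))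
        (≈-trans (+-congˡ (-‿cong (+-congʳ (≈-sym (½x+½x b)))))
          (solve 2 (λ h b′ → h :- (h :+ h :- b′) := b′ :- h) ≈-refl (½ * b) b′))

    0<b′ : 0# < b′
    0<b′ = ≰⇒> λ b′≤0 → <⇒≱ 0<b
      (≤-trans b≤2b′ (≤-respʳ-≈ (+-identityʳ 0#) (+-mono-≤ b′≤0 b′≤0)))

    0<w : 0# < w
    0<w = *-pos (⁻¹-pos 0<b) (⁻¹-pos 0<b′)

    i′≤2i : i′ ≤ i + i
    i′≤2i = ≤-respʳ-≈
      (≈-trans (solve 3 (λ b′ i i′ → i′ :* (i :* (b′ :+ b′)) := (i :+ i) :* (b′ :* i′)) ≈-refl b′ i i′)
        (≈-trans (*-congˡ (pos-inverse 0<b′)) (*-identityʳ _)))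
      (≤-respˡ-≈ (≈-trans (*-congˡ (≈-trans (*-comm i b) (pos-inverse 0<b))) (*-identityʳ i′))
        (*-monoˡ-≤ (proj₁ (⁻¹-pos 0<b′)) (*-monoˡ-≤ (proj₁ (⁻¹-pos 0<b)) b≤2b′)))

    wδ≤ε : w * δ ≤ ε
    wδ≤ε = ≤-trans (*-monoˡ-≤ (proj₁ 0<w) (x⊓y≤y (½ * b) _))
      (≤-respˡ-≈ (solve 3 (λ i i′ η → i :* η :* i′ := i :* i′ :* η) ≈-refl i i′ η)
        (≤-respʳ-≈ iη2i≈ε (*-monoˡ-≤ (*-nonneg (proj₁ (⁻¹-pos 0<b)) 0≤η) i′≤2i)))
      where
      η = ½ * (ε * (b * b))
      0≤η : 0# ≤ η
      0≤η = *-nonneg (proj₁ 0<½) (*-nonneg (proj₁ 0<ε) (square-nonneg b))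
      iη2i≈ε : i * η * (i + i) ≈ ε
      iη2i≈ε = ≈-trans
        (solve 4 (λ i h ε b → i :* (h :* (ε :* (b :* b))) :* (i :+ i)
                   := (h :* ε :+ h :* ε) :* ((b :* i) :* (b :* i))) ≈-refl i ½ ε b)
        (≈-trans (*-cong (½x+½x ε) (*-cong (pos-inverse 0<b) (pos-inverse 0<b)))
          (≈-trans (*-congˡ (*-identityˡ 1#)) (*-identityʳ ε)))

    eq : w * (b′ - b) ≈ i - i′
    eq = ≈-trans
      (solve 4 (λ b b′ i i′ → i :* i′ :* (b′ :- b) := i :* (b′ :* i′) :- i′ :* (b :* i)) ≈-refl b b′ i i′)
      (+-cong (≈-trans (*-congˡ (pos-inverse 0<b′)) (*-identityʳ i))
              (-‿cong (≈-trans (*-congˡ (pos-inverse 0<b)) (*-identityʳ i′))))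

  continuous-⁻¹ : ∀ {f} {x : ℝ^ m} → 0# < f x → ContinuousAt f x → ContinuousAt (λ y → f y ⁻¹) x
  continuous-⁻¹ {f = f} {x} 0<fx fc ε 0<ε =
    let (δ , 0<δ , close) = fc ((½ * f x) ⊓ (½ * (ε * (f x * f x))))
          (⊓-pos (*-pos 0<½ 0<fx) (*-pos 0<½ (*-pos 0<ε (*-pos 0<fx 0<fx)))) in
    δ , 0<δ , λ y near → ⁻¹-close 0<fx 0<ε (close y near)

  _≋_ : ℝ^ m → ℝ^ m → Set
  x ≋ y = ∀ i → x i ≈ y i

  ContinuousMapAt : (ℝ^ m → ℝ^ k) → ℝ^ m → Set
  ContinuousMapAt f x = ∀ ε → 0# < ε →
    ∃[ δ ] 0# < δ × (∀ y → Near δ x y → Near ε (f x) (f y))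

  continuous-map : ∀ k {f : ℝ^ m → ℝ^ k} {x} →
                   (∀ i → ContinuousAt (λ y → f y i) x) → ContinuousMapAt f x
  continuous-map ℕ.zero    fc ε 0<ε = 1# , 0<1 , λ y _ ()
  continuous-map (ℕ.suc k) fc ε 0<ε =
    let (δ , 0<δ , close)    = fc 0F ε 0<ε
        (δ′ , 0<δ′ , close′) = continuous-map k (fc ∘ suc) ε 0<ε in
    δ ⊓ δ′ , ⊓-pos 0<δ 0<δ′ , λ
      { y near 0F    → close y (Near-mono (x⊓y≤x δ δ′) near)
      ; y near (suc i) → close′ y (Near-mono (x⊓y≤y δ δ′) near) i }

  -- Points equal up to `≈` are within every δ, so their values are within every ε. Congruence thus
  -- follows from continuity, even for the norm, whose square root is obtained from a supremum that
  -- is not assumed to respect `≈`.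
  continuous-cong : ∀ {f : ℝ^ m → Carrier} {x y} → ContinuousAt f x → x ≋ y → f x ≈ f y
  continuous-cong {f = f} {x} {y} fc x≋y =
    ≈-trans (solve 2 (λ a b → a := a :- b :+ b) ≈-refl (f x) (f y))
      (≈-trans (+-congʳ (Within-all⇒≈0 λ ε 0<ε →
        let (δ , 0<δ , close) = fc ε 0<ε in close y λ i →
          Within-resp (≈-sym (≈-trans (+-congˡ (-‿cong (≈-sym (x≋y i)))) (-‿inverseʳ (x i))))
            (<-respʳ-≈ -0#≈0# (neg-mono-< 0<δ) , 0<δ)))
        (+-identityˡ _))

  continuous-map-cong : ∀ {f : ℝ^ m → ℝ^ k} {x y} → ContinuousMapAt f x → x ≋ y → f x ≋ f y
  continuous-map-cong {f = f} fc x≋y i = continuous-cong {f = λ z → f z i}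
    (λ ε 0<ε → let (δ , 0<δ , close) = fc ε 0<ε in δ , 0<δ , λ y near → close y near i) x≋y

  infix 4 _≃_

  -- The maps are defined on the ambient spaces, so that they can be given by
  -- formulas; only their restrictions to the regions matter.
  record _≃_ (X : Region m) (Y : Region k) : Set where
    field
      to              : ℝ^ m → ℝ^ k
      from            : ℝ^ k → ℝ^ m
      to-region       : ∀ {x} → X x → Y (to x)
      from-region     : ∀ {y} → Y y → X (from y)
      from-to         : ∀ {x} → X x → from (to x) ≋ x
      to-from         : ∀ {y} → Y y → to (from y) ≋ y
      to-continuous   : ∀ {x} → X x → ContinuousMapAt to x
      from-continuous : ∀ {y} → Y y → ContinuousMapAt from y

  ≃-sym : {X : Region m} {Y : Region k} → X ≃ Y → Y ≃ X
  ≃-sym h = record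
    { to = from ; from = to ; to-region = from-region ; from-region = to-region
    ; from-to = to-from ; to-from = from-to
    ; to-continuous = from-continuous ; from-continuous = to-continuous }
    where open _≃_ h

  ≃-identity : {X Y : Region m} → (∀ {x} → X x → Y x) → (∀ {x} → Y x → X x) → X ≃ Y
  ≃-identity X⊆Y Y⊆X = record
    { to = λ x → x ; from = λ x → x ; to-region = X⊆Y ; from-region = Y⊆X
    ; from-to = λ _ _ → ≈-refl ; to-from = λ _ _ → ≈-refl
    ; to-continuous = λ _ ε 0<ε → ε , 0<ε , λ _ near → near
    ; from-continuous = λ _ ε 0<ε → ε , 0<ε , λ _ near → near }

  ∘-continuous : ∀ {g : ℝ^ k → ℝ^ l} {f : ℝ^ m → ℝ^ k} {x} →
    ContinuousMapAt g (f x) → ContinuousMapAt f x → ContinuousMapAt (g ∘ f) x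
  ∘-continuous {f = f} gc fc ε 0<ε =
    let (δ , 0<δ , g-close)  = gc ε 0<ε
        (δ′ , 0<δ′ , f-close) = fc δ 0<δ in
    δ′ , 0<δ′ , λ y near → g-close (f y) (f-close y near)

  ≃-trans : {X : Region m} {Y : Region k} {Z : Region l} → X ≃ Y → Y ≃ Z → X ≃ Z
  ≃-trans g h = record
    { to = H.to ∘ G.to ; from = G.from ∘ H.from
    ; to-region = H.to-region ∘ G.to-region ; from-region = G.from-region ∘ H.from-region
    ; from-to = λ Xx i → ≈-trans
        (continuous-map-cong (G.from-continuous (H.from-region (H.to-region (G.to-region Xx))))
          (H.from-to (G.to-region Xx)) i)
        (G.from-to Xx i)
    ; to-from = λ Zz i → ≈-trans
        (continuous-map-cong (H.to-continuous (G.to-region (G.from-region (H.from-region Zz))))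
          (G.to-from (H.from-region Zz)) i)
        (H.to-from Zz i)
    ; to-continuous = λ Xx → ∘-continuous (H.to-continuous (G.to-region Xx)) (G.to-continuous Xx)
    ; from-continuous = λ Zz → ∘-continuous (G.from-continuous (H.from-region Zz)) (H.from-continuous Zz) }
    where
    module G = _≃_ g
    module H = _≃_ h

  ≃⇒Homeomorphism : {X : Region m} {Y : Region k} → X ≃ Y → Homeomorphism X Y
  ≃⇒Homeomorphism h = record
    { bijection = record
      { to        = λ (x , Xx) → to x , to-region Xx
      ; from      = λ (y , Yy) → from y , from-region Yy
      ; to-cong   = λ {(_ , Xx)} x≋x′ → continuous-map-cong (to-continuous Xx) x≋x′
      ; from-cong = λ {(_ , Yy)} y≋y′ → continuous-map-cong (from-continuous Yy) y≋y′
      ; inverse   =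
          (λ {(y , Yy)} {(x , Xx)} x≋fy i →
            ≈-trans (continuous-map-cong (to-continuous Xx) x≋fy i) (to-from Yy i)) ,
          (λ {(x , Xx)} {(y , Yy)} y≋tx i →
            ≈-trans (continuous-map-cong (from-continuous Yy) y≋tx i) (from-to Xx i)) }
    ; to-continuous   = λ (x , Xx) ε 0<ε →
        let (δ , 0<δ , close) = to-continuous Xx ε 0<ε in δ , 0<δ , λ (y , _) → close y
    ; from-continuous = λ (y , Yy) ε 0<ε →
        let (δ , 0<δ , close) = from-continuous Yy ε 0<ε in δ , 0<δ , λ (x , _) → close x }
    where open _≃_ h

  -- Homogeneity concerns nonnegative factors, because the gauge of a simplex about its barycentre
  -- is not symmetric under x ↦ - x.
  record Gauge (N : ℝ^ m → Carrier) : Set where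
    field
      nonneg     : ∀ x → 0# ≤ N x
      scale      : ∀ {c} → 0# ≤ c → ∀ x → N (λ i → c * x i) ≈ c * N x
      definite   : ∀ {x} → N x ≈ 0# → ∀ i → x i ≈ 0#
      continuous : ∀ x → ContinuousAt N x

    zero-value : ∀ {x} → (∀ i → x i ≈ 0#) → N x ≈ 0#
    zero-value {x} x≈0 = ≈-trans
      (continuous-cong (continuous x) (λ i → ≈-trans (x≈0 i) (≈-sym (zeroˡ (x i)))))
      (≈-trans (scale ≤-refl x) (zeroˡ _))

  -- On the ray through u with N u ≈ 1 and M u ≈ c, the map x ↦ x / (1 - N x + M x) is
  -- r u ↦ r / (1 - r + r c) u, whose inverse is the same formula with N and M exchanged.
  module Radial {N M : ℝ^ m → Carrier} (N-gauge : Gauge N) (M-gauge : Gauge M) where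
    private
      module N = Gauge N-gauge
      module M = Gauge M-gauge

    denominator : ℝ^ m → Carrier
    denominator x = 1# - N x + M x

    -- If N x < 1, then 1 - N x is positive already. If N x = 1, then x is not the origin, so M x is
    -- positive.
    denominator-pos : ∀ {x} → N x ≤ 1# → 0# < denominator x
    denominator-pos {x} Nx≤1 with N x ≟ 1#
    ... | no Nx≉1  = +-pos-nonneg (x<y⇒0<y-x (Nx≤1 , Nx≉1)) (M.nonneg x)
    ... | yes Nx≈1 = +-nonneg-pos (x≤y⇒0≤y-x Nx≤1)
      (M.nonneg x , λ 0≈Mx → 0≉1 (≈-trans (≈-sym (N.zero-value (M.definite (≈-sym 0≈Mx)))) Nx≈1))

    radial : ℝ^ m → ℝ^ m
    radial x i = denominator x ⁻¹ * x i

    radial-continuous : ∀ {x} → N x ≤ 1# → ContinuousMapAt radial x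
    radial-continuous {x} Nx≤1 = continuous-map _ λ i → continuous-*
      (continuous-⁻¹ (denominator-pos Nx≤1)
        (continuous-+ (continuous-+ (continuous-const 1#) (continuous-neg (N.continuous x)))
                      (M.continuous x)))
      (continuous-coordinate i)

    module _ {x} (Nx≤1 : N x ≤ 1#) where
      private
        D = denominator x
        D⁻¹-nonneg : 0# ≤ D ⁻¹
        D⁻¹-nonneg = proj₁ (⁻¹-pos (denominator-pos Nx≤1))
        D⁻¹*D≈1 : D ⁻¹ * D ≈ 1#
        D⁻¹*D≈1 = ≈-trans (*-comm _ _) (pos-inverse (denominator-pos Nx≤1))

      -- With D = 1 - N x + M x, the claim M x / D ≤ 1 amounts to 0 ≤ D - M x = 1 - N x.
      radial-region : M (radial x) ≤ 1#
      radial-region = ≤-respˡ-≈ (≈-sym (M.scale D⁻¹-nonneg x)) $ ≤-respʳ-≈ D⁻¹*D≈1 $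
        *-monoˡ-≤ D⁻¹-nonneg $ ≤-from (x≤y⇒0≤y-x Nx≤1) $
        solve 2 (λ N M → con (+ 1) :- N := con (+ 1) :- N :+ M :- M) ≈-refl (N x) (M x)

      -- Since D - M x + N x = 1, division by D leaves 1 / D. The return map therefore multiplies by
      -- D.
      swapped-denominator : 1# - M (radial x) + N (radial x) ≈ D ⁻¹
      swapped-denominator = ≈-trans
        (+-cong (+-cong (≈-sym D⁻¹*D≈1) (-‿cong (M.scale D⁻¹-nonneg x))) (N.scale D⁻¹-nonneg x))
        (solve 3 (λ k N M → k :* (con (+ 1) :- N :+ M) :- k :* M :+ k :* N := k) ≈-refl (D ⁻¹) (N x) (M x))

      radial-inverse : ∀ i → (1# - M (radial x) + N (radial x)) ⁻¹ * radial x i ≈ x i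
      radial-inverse i = ≈-trans (≈-sym (*-assoc _ _ _))
        (≈-trans (*-congʳ (≈-trans (*-comm _ _) (≈-trans (*-congʳ (≈-sym swapped-denominator))
          (pos-inverse (<-respʳ-≈ (≈-sym swapped-denominator) (⁻¹-pos (denominator-pos Nx≤1)))))))
          (*-identityˡ (x i)))

  gauges≃ : {N M : ℝ^ m → Carrier} → Gauge N → Gauge M → (λ x → N x ≤ 1#) ≃ (λ x → M x ≤ 1#)
  gauges≃ N-gauge M-gauge = record
    { to = NM.radial ; from = MN.radial
    ; to-region = NM.radial-region ; from-region = MN.radial-region
    ; from-to = NM.radial-inverse ; to-from = MN.radial-inverse
    ; to-continuous = NM.radial-continuous ; from-continuous = MN.radial-continuous }
    where
    module NM = Radial N-gauge M-gauge
    module MN = Radial M-gauge N-gauge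

-- Square roots from least upper bounds

module SquareRoots (ℝ : Reals) where
  open Reals ℝ
  open OrderedField ℝ

  square-cancel-≤ : ∀ {s t} → 0# ≤ s → 0# ≤ t → s * s ≤ t * t → s ≤ t
  square-cancel-≤ {s} {t} 0≤s 0≤t ss≤tt with s ≤? t
  ... | yes s≤t = s≤t
  ... | no s≰t  = contradiction ss≤tt (<⇒≱ (≤-<-trans
    (≤-respʳ-≈ (*-comm t s) (*-monoˡ-≤ 0≤t (proj₁ t<s))) (*-monoˡ-< (≤-<-trans 0≤t t<s) t<s)))
    where
    t<s : t < s
    t<s = ≰⇒> s≰t

  square-injective : ∀ {s t} → 0# ≤ s → 0# ≤ t → s * s ≈ t * t → s ≈ t
  square-injective 0≤s 0≤t ss≈tt = antisym
    (square-cancel-≤ 0≤s 0≤t (≤-reflexive ss≈tt))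
    (square-cancel-≤ 0≤t 0≤s (≤-reflexive (≈-sym ss≈tt)))

  square-root : ∀ a → 0# ≤ a → ∃[ s ] 0# ≤ s × s * s ≈ a
  square-root a 0≤a with supremum Below (0# , ≤-refl , ≤-respˡ-≈ (≈-sym (zeroˡ 0#)) 0≤a) (1# + a , below-bound)
    where
    Below : Pred Carrier 0ℓ
    Below t = 0# ≤ t × t * t ≤ a

    below-bound : ∀ {t} → Below t → t ≤ 1# + a
    below-bound (0≤t , tt≤a) = square-cancel-≤ 0≤t (+-nonneg 0≤1 0≤a) $ ≤-trans tt≤a $
      ≤-from (+-nonneg (+-nonneg 0≤1 0≤a) (square-nonneg a))
        (solve 1 (λ a → con (+ 1) :+ a :+ a :* a
                   := (con (+ 1) :+ a) :* (con (+ 1) :+ a) :- a) ≈-refl a)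
  ... | s , upper , least = s , 0≤s , ss≈a
    where
    0≤s : 0# ≤ s
    0≤s = upper (≤-refl , ≤-respˡ-≈ (≈-sym (zeroˡ 0#)) 0≤a)

    -- For 0 ≤ h ≤ 1 one has (s + h)² ≤ s² + D h, and (s - h)² ≥ s² - D h for every h ≥ 0. If s² <
    -- a, a small h gives an element s + h of `Below` above its supremum; if s² > a, then h = (s² -
    -- a) / D gives an upper bound s - h below it.
    D = s + s + 1#

    0<D : 0# < D
    0<D = +-nonneg-pos (+-nonneg 0≤s 0≤s) 0<1

    D*[D⁻¹*x]≈x : ∀ x → D * (D ⁻¹ * x) ≈ x
    D*[D⁻¹*x]≈x x = ≈-trans (≈-sym (*-assoc _ _ _)) (≈-trans (*-congʳ (pos-inverse 0<D)) (*-identityˡ x))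

    not-below : ¬ (s * s < a)
    not-below ss<a = <⇒≱ (x<x+y 0<h) (upper (+-nonneg 0≤s (proj₁ 0<h) , [s+h]²≤a))
      where
      h = 1# ⊓ (D ⁻¹ * (a - s * s))
      0<h : 0# < h
      0<h = ⊓-pos 0<1 (*-pos (⁻¹-pos 0<D) (x<y⇒0<y-x ss<a))
      hD≤a-ss : D * h ≤ a - s * s
      hD≤a-ss = ≤-respʳ-≈ (D*[D⁻¹*x]≈x _) (*-monoˡ-≤ (proj₁ 0<D) (x⊓y≤y 1# _))
      [s+h]²≤a : (s + h) * (s + h) ≤ a
      [s+h]²≤a = ≤-from
        (+-nonneg (x≤y⇒0≤y-x hD≤a-ss) (*-nonneg (proj₁ 0<h) (x≤y⇒0≤y-x (x⊓y≤x 1# (D ⁻¹ * (a - s * s))))))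
        (solve 3 (λ a s h → (a :- s :* s :- (s :+ s :+ con (+ 1)) :* h) :+ h :* (con (+ 1) :- h)
                   := a :- (s :+ h) :* (s :+ h)) ≈-refl a s h)

    not-above : ¬ (a < s * s)
    not-above a<ss = <⇒≱ b<s (least λ (0≤t , tt≤a) → square-cancel-≤ 0≤t 0≤b (≤-trans tt≤a a≤bb))
      where
      h = D ⁻¹ * (s * s - a)
      b = s - h
      0<h : 0# < h
      0<h = *-pos (⁻¹-pos 0<D) (x<y⇒0<y-x a<ss)
      a≈ : a ≈ s * s - D * h
      a≈ = ≈-trans (solve 2 (λ a r → a := r :- (r :- a)) ≈-refl a (s * s))
        (+-congˡ (-‿cong (≈-sym (D*[D⁻¹*x]≈x _))))
      b<s : b < s
      b<s = <-from 0<h (solve 2 (λ s h → h := s :- (s :- h)) ≈-refl s h)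
      0≤b : 0# ≤ b
      -- By the choice of h, D b = s² + s + a.
      0≤b = *-cancelˡ-≤ 0<D $ ≤-respˡ-≈ (≈-sym (zeroʳ D)) $
        ≤-respʳ-≈ (≈-trans (+-congˡ a≈) (solve 2 (λ s h →
            s :* s :+ s :+ (s :* s :- (s :+ s :+ con (+ 1)) :* h) := (s :+ s :+ con (+ 1)) :* (s :- h)) ≈-refl s h))
          (+-nonneg (+-nonneg (square-nonneg s) 0≤s) 0≤a)
      a≤bb : a ≤ b * b
      a≤bb = ≤-from (+-nonneg (square-nonneg h) (proj₁ 0<h)) $ ≈-trans
        (solve 2 (λ s h → h :* h :+ h := (s :- h) :* (s :- h) :- (s :* s :- (s :+ s :+ con (+ 1)) :* h)) ≈-refl s h)
        (+-congˡ (-‿cong (≈-sym a≈)))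

    ss≈a : s * s ≈ a
    ss≈a with s * s ≟ a | total (s * s) a
    ... | yes ss≈a | _         = ss≈a
    ... | no ss≉a  | inj₁ ss≤a = contradiction (ss≤a , ss≉a) not-below
    ... | no ss≉a  | inj₂ a≤ss = contradiction (a≤ss , ss≉a ∘ ≈-sym) not-above

-- The Euclidean norm as a gauge

module EuclideanNorm (ℝ : Reals) where
  open Reals ℝ
  open Topology ℝ
  open OrderedField ℝ
  open Continuity ℝ
  open Homeomorphisms ℝ
  open SquareRoots ℝ
  open SemiringSum semiring using (sum-cong-≋; *-distribˡ-sum)

  private variable
    m : ℕ

  sum-nonneg : (x : ℝ^ m) → (∀ i → 0# ≤ x i) → 0# ≤ sum x
  sum-nonneg {ℕ.zero}  x 0≤x = ≤-refl
  sum-nonneg {ℕ.suc m} x 0≤x = +-nonneg {x 0F} {sum (x ∘ suc)} (0≤x 0F) (sum-nonneg (x ∘ suc) (0≤x ∘ suc))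

  sum-nonneg≈0 : (x : ℝ^ m) → (∀ i → 0# ≤ x i) → sum x ≈ 0# → ∀ i → x i ≈ 0#
  sum-nonneg≈0 {ℕ.suc m} x 0≤x Σx≈0 = λ
    { 0F      → proj₁ both≈0
    ; (suc i) → sum-nonneg≈0 (x ∘ suc) (0≤x ∘ suc) (proj₂ both≈0) i }
    where
    both≈0 : x 0F ≈ 0# × sum (x ∘ suc) ≈ 0#
    both≈0 = +-nonneg≈0 {x 0F} {sum (x ∘ suc)} (0≤x 0F) (sum-nonneg (x ∘ suc) (0≤x ∘ suc)) Σx≈0

  continuous-sum : ∀ {k} {f : Fin k → ℝ^ m → Carrier} {x} → (∀ i → ContinuousAt (f i) x) →
                   ContinuousAt (λ y → sum (λ i → f i y)) x
  continuous-sum {k = ℕ.zero}  fc = continuous-const 0#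
  continuous-sum {k = ℕ.suc k} fc = continuous-+ (fc 0F) (continuous-sum (fc ∘ suc))

  sum-of-squares : ℝ^ m → Carrier
  sum-of-squares x = sum (λ i → x i * x i)

  sum-of-squares-nonneg : (x : ℝ^ m) → 0# ≤ sum-of-squares x
  sum-of-squares-nonneg x = sum-nonneg _ (λ i → square-nonneg (x i))

  opaque
    -- The norm is used only through `norm-nonneg` and `norm²`; opacity keeps the supremum behind it
    -- from being unfolded.
    norm : ℝ^ m → Carrier
    norm x = proj₁ (square-root (sum-of-squares x) (sum-of-squares-nonneg x))

    norm-nonneg : (x : ℝ^ m) → 0# ≤ norm x
    norm-nonneg x = proj₁ (proj₂ (square-root (sum-of-squares x) (sum-of-squares-nonneg x)))

    norm² : (x : ℝ^ m) → norm x * norm x ≈ sum-of-squares x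
    norm² x = proj₂ (proj₂ (square-root (sum-of-squares x) (sum-of-squares-nonneg x)))

  sum-of-squares-scale : ∀ c (x : ℝ^ m) → sum-of-squares (λ i → c * x i) ≈ c * c * sum-of-squares x
  sum-of-squares-scale c x = ≈-trans
    (sum-cong-≋ λ i → solve 2 (λ c x → c :* x :* (c :* x) := c :* c :* (x :* x)) ≈-refl c (x i))
    (≈-sym (*-distribˡ-sum (c * c) (λ i → x i * x i)))

  root-scale : ∀ {r s c q} → 0# ≤ r → 0# ≤ s → 0# ≤ c → s * s ≈ q → r * r ≈ c * c * q → r ≈ c * s
  root-scale {r} {s} {c} 0≤r 0≤s 0≤c ss≈q rr≈ccq = square-injective 0≤r (*-nonneg 0≤c 0≤s) $
    ≈-trans rr≈ccq $ ≈-trans (*-congˡ (≈-sym ss≈q)) $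
    solve 2 (λ c s → c :* c :* (s :* s) := c :* s :* (c :* s)) ≈-refl c s

  norm-scale : ∀ {c} → 0# ≤ c → (x : ℝ^ m) → norm (λ i → c * x i) ≈ c * norm x
  norm-scale {c = c} 0≤c x = root-scale (norm-nonneg (λ i → c * x i)) (norm-nonneg x) 0≤c (norm² x)
    (≈-trans (norm² (λ i → c * x i)) (sum-of-squares-scale c x))

  square-of-zero : ∀ {s q} → s * s ≈ q → s ≈ 0# → q ≈ 0#
  square-of-zero ss≈q s≈0 = ≈-trans (≈-sym ss≈q) (≈-trans (*-congʳ s≈0) (zeroˡ _))

  norm-definite : (x : ℝ^ m) → norm x ≈ 0# → ∀ i → x i ≈ 0#
  norm-definite x n≈0 i = square≈0
    (sum-nonneg≈0 (λ i → x i * x i) (λ i → square-nonneg (x i)) (square-of-zero (norm² x) n≈0) i)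

  -- If s ≥ t + ε, then s² ≥ t² + 2 t ε + ε² ≥ t² + ε². Hence the δ that serves ε² for the squares
  -- serves ε for the roots.
  difference-of-roots : ∀ {s t ε} → 0# ≤ s → 0# ≤ t → 0# < ε → s * s - t * t < ε * ε → s - t < ε
  difference-of-roots {s} {t} {ε} 0≤s 0≤t 0<ε ss-tt<εε = ≰⇒> λ ε≤s-t → <⇒≱ ss-tt<εε $
    ≤-trans (≤-from (*-nonneg (proj₁ 0<ε) (+-nonneg 0≤t 0≤t))
              (solve 2 (λ t ε → ε :* (t :+ t) := (t :+ ε) :* (t :+ ε) :- t :* t :- ε :* ε) ≈-refl t ε))
      (+-mono-≤ (square-mono (+-nonneg 0≤t (proj₁ 0<ε))
        (≤-from (x≤y⇒0≤y-x ε≤s-t) (solve 3 (λ s t ε → s :- t :- ε := s :- (t :+ ε)) ≈-refl s t ε))) ≤-refl)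
    where
    square-mono : ∀ {u v} → 0# ≤ u → u ≤ v → u * u ≤ v * v
    square-mono {u} {v} 0≤u u≤v = ≤-trans (*-monoˡ-≤ 0≤u u≤v)
      (≤-respˡ-≈ (*-comm v u) (*-monoˡ-≤ (≤-trans 0≤u u≤v) u≤v))

  norm-continuous : (x : ℝ^ m) → ContinuousAt norm x
  norm-continuous x ε 0<ε =
    let (δ , 0<δ , close) = continuous-sum
          (λ i → continuous-* (continuous-coordinate i) (continuous-coordinate i)) (ε * ε) (*-pos 0<ε 0<ε) in
    δ , 0<δ , λ y near →
      <-respʳ-≈ (solve 2 (λ s t → :- (t :- s) := s :- t) ≈-refl (norm x) (norm y))
        (neg-mono-< (difference-of-roots (norm-nonneg y) (norm-nonneg x) 0<ε
          (squares y x (proj₂ (Within-swap (close y near)))))) ,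
      difference-of-roots (norm-nonneg x) (norm-nonneg y) 0<ε (squares x y (proj₂ (close y near)))
    where
    squares : ∀ (x y : ℝ^ _) {η} → sum-of-squares x - sum-of-squares y < η →
              norm x * norm x - norm y * norm y < η
    squares x y = <-respˡ-≈ (≈-sym (+-cong (norm² x) (-‿cong (norm² y))))

  norm-gauge : Gauge (norm {m})
  norm-gauge = record
    { nonneg     = norm-nonneg
    ; scale      = norm-scale
    ; definite   = λ {x} → norm-definite x
    ; continuous = norm-continuous }

  norm-ball≃Ball : (λ (x : ℝ^ m) → norm x ≤ 1#) ≃ Ball m
  norm-ball≃Ball = ≃-identity
    (λ {x} n≤1 → ≤-respˡ-≈ (norm² x) (≤-trans (*-monoˡ-≤ (norm-nonneg x) n≤1) (≤-respˡ-≈ (≈-sym (*-identityʳ _)) n≤1)))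
    (λ {x} q≤1 → square-cancel-≤ (norm-nonneg x) 0≤1
      (≤-respˡ-≈ (≈-sym (norm² x)) (≤-respʳ-≈ (≈-sym (*-identityˡ 1#)) q≤1)))

-- The tetrahedron is homeomorphic to the ball

fullSimplex : ∀ k → Subset (4 ℕ.+ k)
fullSimplex k = inside ∷ inside ∷ inside ∷ inside ∷ ⊥

module Simplices (ℝ : Reals) where
  open Reals ℝ
  open Topology ℝ
  open OrderedField ℝ
  open Continuity ℝ
  open Homeomorphisms ℝ
  open EuclideanNorm ℝ

  -- The realization expressed by facets alone: order and repetition in the list do not matter, and
  -- a change of triangulation becomes a computation on lists.
  Supported : List (Subset n) → Region n
  Supported fs x = (∀ v → 0# ≤ x v) × sum x ≈ 1# × ∃[ f ] f List.∈ fs × (∀ v → v ∉ f → x v ≈ 0#)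

  sum-zero : (x : ℝ^ n) → (∀ v → x v ≈ 0#) → sum x ≈ 0#
  sum-zero {ℕ.zero}  x x≈0 = ≈-refl
  sum-zero {ℕ.suc n} x x≈0 =
    ≈-trans (+-cong (x≈0 0F) (sum-zero (x ∘ suc) (x≈0 ∘ suc))) (+-identityˡ 0#)

  -- The least mass μ on vertex 0 for which μ and all y i + μ are nonnegative. The gauge below is
  -- the total mass of this least representative.
  excess : ℝ^ 3 → Carrier
  excess y = 0# ⊔ - y 0F ⊔ - y 1F ⊔ - y 2F

  -- In the coordinates y i = x (i + 1) - x 0 the barycentre of the 3-simplex is the origin
  -- and this is the gauge of the simplex.
  simplex-norm : ℝ^ 3 → Carrier
  simplex-norm y = let μ = excess y in (y 0F + μ) + (y 1F + μ) + (y 2F + μ) + μ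

  private
    0≤y+μ : ∀ {y μ} → - y ≤ μ → 0# ≤ y + μ
    0≤y+μ {y} {μ} -y≤μ = ≤-respʳ-≈ (solve 2 (λ y μ → μ :- :- y := y :+ μ) ≈-refl y μ) (x≤y⇒0≤y-x -y≤μ)

  module _ (y : ℝ^ 3) where
    private
      a = 0# ⊔ - y 0F
      b = a ⊔ - y 1F

    0≤excess : 0# ≤ excess y
    0≤excess = ≤-trans (x≤x⊔y 0# (- y 0F)) (≤-trans (x≤x⊔y a (- y 1F)) (x≤x⊔y b (- y 2F)))

    0≤y+excess : ∀ i → 0# ≤ y i + excess y
    0≤y+excess 0F = 0≤y+μ (≤-trans (y≤x⊔y 0# (- y 0F)) (≤-trans (x≤x⊔y a (- y 1F)) (x≤x⊔y b (- y 2F))))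
    0≤y+excess 1F = 0≤y+μ (≤-trans (y≤x⊔y a (- y 1F)) (x≤x⊔y b (- y 2F)))
    0≤y+excess 2F = 0≤y+μ (y≤x⊔y b (- y 2F))

    excess-lub : ∀ {z} → 0# ≤ z → (∀ i → - y i ≤ z) → excess y ≤ z
    excess-lub 0≤z -y≤z = ⊔-lub (⊔-lub (⊔-lub 0≤z (-y≤z 0F)) (-y≤z 1F)) (-y≤z 2F)

    excess-scale : ∀ {c} → 0# ≤ c → excess (λ i → c * y i) ≈ c * excess y
    excess-scale {c} 0≤c =
      ≈-trans (⊔-cong (≈-trans (⊔-cong (≈-trans (⊔-cong (≈-sym (zeroʳ c)) (-c* (y 0F)))
        (*-distribˡ-⊔ 0# (- y 0F) 0≤c)) (-c* (y 1F))) (*-distribˡ-⊔ a (- y 1F) 0≤c)) (-c* (y 2F)))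
        (*-distribˡ-⊔ b (- y 2F) 0≤c)
      where
      -c* : ∀ x → - (c * x) ≈ c * - x
      -c* x = solve 2 (λ c x → :- (c :* x) := c :* :- x) ≈-refl c x

    excess-continuous : ContinuousAt excess y
    excess-continuous = continuous-⊔ (continuous-⊔ (continuous-⊔ (continuous-const 0#)
      (continuous-neg (continuous-coordinate 0F))) (continuous-neg (continuous-coordinate 1F)))
      (continuous-neg (continuous-coordinate 2F))

  simplex-gauge : Gauge simplex-norm
  simplex-gauge = record
    { nonneg     = λ y → +-nonneg (first-three y) (0≤excess y)
    ; scale      = λ {c} 0≤c y → ≈-trans
        (let μ≈ = excess-scale y 0≤c in
          +-cong (+-cong (+-cong (+-congˡ μ≈) (+-congˡ μ≈)) (+-congˡ μ≈)) μ≈)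
        (solve 5 (λ c x y z μ → c :* x :+ c :* μ :+ (c :* y :+ c :* μ) :+ (c :* z :+ c :* μ) :+ c :* μ
                    := c :* (x :+ μ :+ (y :+ μ) :+ (z :+ μ) :+ μ)) ≈-refl c (y 0F) (y 1F) (y 2F) (excess y))
    ; definite   = λ {y} N≈0 →
        let (three≈0 , μ≈0) = +-nonneg≈0 (first-three y) (0≤excess y) N≈0
            (two≈0 , ≈0₂)   = +-nonneg≈0 (+-nonneg (0≤y+excess y 0F) (0≤y+excess y 1F)) (0≤y+excess y 2F) three≈0
            (≈0₀ , ≈0₁)     = +-nonneg≈0 (0≤y+excess y 0F) (0≤y+excess y 1F) two≈0 in
        λ { 0F → cancel μ≈0 ≈0₀ ; 1F → cancel μ≈0 ≈0₁ ; 2F → cancel μ≈0 ≈0₂ }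
    ; continuous = λ y →
        let yi+μ = λ i → continuous-+ (continuous-coordinate i) (excess-continuous y) in
        continuous-+ (continuous-+ (continuous-+ (yi+μ 0F) (yi+μ 1F)) (yi+μ 2F)) (excess-continuous y) }
    where
    first-three : ∀ y → 0# ≤ (y 0F + excess y) + (y 1F + excess y) + (y 2F + excess y)
    first-three y = +-nonneg (+-nonneg (0≤y+excess y 0F) (0≤y+excess y 1F)) (0≤y+excess y 2F)
    cancel : ∀ {y μ} → μ ≈ 0# → y + μ ≈ 0# → y ≈ 0#
    cancel μ≈0 y+μ≈0 = ≈-trans (≈-sym (+-identityʳ _)) (≈-trans (+-congˡ (≈-sym μ≈0)) y+μ≈0)

  simplex≃gauge-ball : ∀ k → Supported [ fullSimplex k ] ≃ (λ y → simplex-norm y ≤ 1#)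
  simplex≃gauge-ball k = record
    { to              = relative
    ; from            = barycentric
    ; to-region       = relative-region
    ; from-region     = barycentric-region
    ; from-to         = from-to
    ; to-from         = λ {y} _ → λ
        { 0F → y+c-c (y 0F) (base y) ; 1F → y+c-c (y 1F) (base y) ; 2F → y+c-c (y 2F) (base y) }
    ; to-continuous   = λ _ → continuous-map 3 λ
        { 0F → coordinate-difference 1F ; 1F → coordinate-difference 2F ; 2F → coordinate-difference 3F }
    ; from-continuous = λ _ → continuous-map (4 ℕ.+ k) λ
        { 0F → base-continuous
        ; 1F → continuous-+ (continuous-coordinate 0F) base-continuous
        ; 2F → continuous-+ (continuous-coordinate 1F) base-continuous
        ; 3F → continuous-+ (continuous-coordinate 2F) base-continuous
        ; (suc (suc (suc (suc _)))) → continuous-const 0# } }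
    where
    relative : ℝ^ (4 ℕ.+ k) → ℝ^ 3
    relative x 0F = x 1F - x 0F
    relative x 1F = x 2F - x 0F
    relative x 2F = x 3F - x 0F

    quarter : Carrier → Carrier
    quarter r = ½ * (½ * r)

    4*quarter : ∀ r → quarter r + quarter r + (quarter r + quarter r) ≈ r
    4*quarter r = ≈-trans (+-cong (½x+½x (½ * r)) (½x+½x (½ * r))) (½x+½x r)

    -- The mass c of vertex 0 is determined by c + (y 0 + c) + (y 1 + c) + (y 2 + c) = 1.
    base : ℝ^ 3 → Carrier
    base y = quarter (1# - (y 0F + y 1F + y 2F))

    barycentric : ℝ^ 3 → ℝ^ (4 ℕ.+ k)
    barycentric y 0F = base y
    barycentric y 1F = y 0F + base y
    barycentric y 2F = y 1F + base y
    barycentric y 3F = y 2F + base y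
    barycentric y (suc (suc (suc (suc _)))) = 0#

    base-continuous : ∀ {y} → ContinuousAt base y
    base-continuous = continuous-* (continuous-const ½) (continuous-* (continuous-const ½)
      (continuous-+ (continuous-const 1#) (continuous-neg (continuous-+ (continuous-+
        (continuous-coordinate 0F) (continuous-coordinate 1F)) (continuous-coordinate 2F)))))

    coordinate-difference : ∀ i {x : ℝ^ (4 ℕ.+ k)} → ContinuousAt (λ z → z i - z 0F) x
    coordinate-difference i = continuous-+ (continuous-coordinate i) (continuous-neg (continuous-coordinate 0F))

    y+c-c : ∀ y c → y + c - c ≈ y
    y+c-c = solve 2 (λ y c → y :+ c :- c := y) ≈-refl

    outside-zero : ∀ {x} → Supported [ fullSimplex k ] x → ∀ i → x (suc (suc (suc (suc i)))) ≈ 0#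
    outside-zero (_ , _ , _ , Any.here refl , x≈0) i =
      x≈0 (suc (suc (suc (suc i)))) λ { (there (there (there (there i∈⊥)))) → ∉⊥ i∈⊥ }

    four-sum : ∀ {x} → Supported [ fullSimplex k ] x → x 0F + (x 1F + (x 2F + x 3F)) ≈ 1#
    four-sum {x} Sx@(_ , Σx≈1 , _) = ≈-trans
      (+-congˡ (+-congˡ (+-congˡ (≈-trans (≈-sym (+-identityʳ (x 3F)))
        (+-congˡ (≈-sym (sum-zero (λ i → x (suc (suc (suc (suc i))))) (outside-zero Sx))))))))
      Σx≈1

    relative-region : ∀ {x} → Supported [ fullSimplex k ] x → simplex-norm (relative x) ≤ 1#
    relative-region {x} Sx@(0≤x , _) = ≤-respʳ-≈ (four-sum Sx) $ ≤-respʳ-≈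
      (solve 4 (λ a b c d → b :- a :+ a :+ (c :- a :+ a) :+ (d :- a :+ a) :+ a := a :+ (b :+ (c :+ d)))
        ≈-refl (x 0F) (x 1F) (x 2F) (x 3F))
      (+-mono-≤ (+-mono-≤ (+-mono-≤ (+-mono-≤ ≤-refl μ≤x₀) (+-mono-≤ ≤-refl μ≤x₀)) (+-mono-≤ ≤-refl μ≤x₀)) μ≤x₀)
      where
      -[y-x]≤x : ∀ {x y} → 0# ≤ y → - (y - x) ≤ x
      -[y-x]≤x {x} {y} 0≤y = ≤-from 0≤y (solve 2 (λ x y → y := x :- :- (y :- x)) ≈-refl x y)
      μ≤x₀ : excess (relative x) ≤ x 0F
      μ≤x₀ = excess-lub (relative x) (0≤x 0F) λ
        { 0F → -[y-x]≤x (0≤x 1F) ; 1F → -[y-x]≤x (0≤x 2F) ; 2F → -[y-x]≤x (0≤x 3F) }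

    barycentric-region : ∀ {y} → simplex-norm y ≤ 1# → Supported [ fullSimplex k ] (barycentric y)
    barycentric-region {y} Ny≤1 = nonneg , total-mass , fullSimplex k , Any.here refl , vanishes
      where
      μ = excess y ; c = base y
      μ≤c : μ ≤ c
      -- Four times c - μ is 1 - `simplex-norm` y, hence the two halvings.
      μ≤c = ≤-from (0≤x+x⇒0≤x (0≤x+x⇒0≤x (≤-respʳ-≈
        (≈-trans (+-congʳ (≈-trans
            (solve 1 (λ s → con (+ 1) := con (+ 1) :- s :+ s) ≈-refl (y 0F + y 1F + y 2F))
            (+-congʳ (≈-sym (4*quarter _)))))
          (solve 5 (λ x y z μ c → c :+ c :+ (c :+ c) :+ (x :+ y :+ z) :- (x :+ μ :+ (y :+ μ) :+ (z :+ μ) :+ μ)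
                     := c :- μ :+ (c :- μ) :+ (c :- μ :+ (c :- μ))) ≈-refl (y 0F) (y 1F) (y 2F) μ c))
        (x≤y⇒0≤y-x Ny≤1)))) ≈-refl
      0≤c : 0# ≤ c
      0≤c = ≤-trans (0≤excess y) μ≤c
      0≤y+c : ∀ i → 0# ≤ y i + c
      0≤y+c i = ≤-trans (0≤y+excess y i) (+-mono-≤ ≤-refl μ≤c)
      nonneg : ∀ v → 0# ≤ barycentric y v
      nonneg 0F = 0≤c
      nonneg 1F = 0≤y+c 0F
      nonneg 2F = 0≤y+c 1F
      nonneg 3F = 0≤y+c 2F
      nonneg (suc (suc (suc (suc _)))) = ≤-refl
      total-mass : sum (barycentric y) ≈ 1#
      total-mass = ≈-trans (+-congˡ (+-congˡ (+-congˡ (+-congˡ (sum-zero {k} (λ _ → 0#) (λ _ → ≈-refl)))))) $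
        ≈-trans (solve 4 (λ x y z c → c :+ (x :+ c :+ (y :+ c :+ (z :+ c :+ con (+ 0))))
          := c :+ c :+ (c :+ c) :+ (x :+ y :+ z)) ≈-refl (y 0F) (y 1F) (y 2F) c) $
        ≈-trans (+-congʳ (4*quarter _)) $
        solve 1 (λ s → con (+ 1) :- s :+ s := con (+ 1)) ≈-refl (y 0F + y 1F + y 2F)
      vanishes : ∀ v → v ∉ fullSimplex k → barycentric y v ≈ 0#
      vanishes 0F v∉ = contradiction here v∉
      vanishes 1F v∉ = contradiction (there here) v∉
      vanishes 2F v∉ = contradiction (there (there here)) v∉
      vanishes 3F v∉ = contradiction (there (there (there here))) v∉
      vanishes (suc (suc (suc (suc _)))) v∉ = ≈-refl

    from-to : ∀ {x} → Supported [ fullSimplex k ] x → ∀ v → barycentric (relative x) v ≈ x v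
    from-to {x} Sx = λ
      { 0F → c≈x₀ ; 1F → difference 1F ; 2F → difference 2F ; 3F → difference 3F
      ; (suc (suc (suc (suc i)))) → ≈-sym (outside-zero Sx i) }
      where
      c≈x₀ : base (relative x) ≈ x 0F
      c≈x₀ = ≈-trans (*-congˡ (*-congˡ (+-congʳ (≈-sym (four-sum Sx))))) $ ≈-trans
        (solve 5 (λ h a b c d → h :* (h :* (a :+ (b :+ (c :+ d)) :- (b :- a :+ (c :- a) :+ (d :- a))))
           := h :* (h :* a) :+ h :* (h :* a) :+ (h :* (h :* a) :+ h :* (h :* a))) ≈-refl ½ (x 0F) (x 1F) (x 2F) (x 3F))
        (4*quarter (x 0F))
      difference : ∀ i → x i - x 0F + base (relative x) ≈ x i
      difference i = ≈-trans (+-congˡ c≈x₀) (solve 2 (λ a b → b :- a :+ a := b) ≈-refl (x 0F) (x i))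

  simplex≃Ball : ∀ k → Supported [ fullSimplex k ] ≃ Ball 3
  simplex≃Ball k = ≃-trans (simplex≃gauge-ball k) (≃-trans (gauges≃ simplex-gauge norm-gauge) norm-ball≃Ball)

-- Edge subdivision of a list of facets

_≟ˢ_ : DecidableEquality (Subset n)
_≟ˢ_ = ≡-dec _≟ᵇ_

exchange : Subset n → Fin n → Fin n → Subset n
exchange f v a = (f [ v ]≔ outside) [ a ]≔ inside

∈-exchange⁻ : ∀ {f : Subset n} {v a w} → w ∈ exchange f v a → w ≡ a ⊎ (w ≢ v × w ∈ f)
∈-exchange⁻ {f = f} {v} {a} {w} w∈ with w Fin.≟ a | w Fin.≟ v
... | yes w≡a | _       = inj₁ w≡a
... | no w≢a  | yes refl = contradiction
  (trans (sym (lookup∘update v f outside)) (trans (sym (lookup∘update′ w≢a (f [ v ]≔ outside) inside)) ([]=⇒lookup w∈)))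
  λ ()
... | no w≢a  | no w≢v  = inj₂ (w≢v , lookup⇒[]= w f
  (trans (sym (lookup∘update′ w≢v f outside)) (trans (sym (lookup∘update′ w≢a (f [ v ]≔ outside) inside)) ([]=⇒lookup w∈))))

∈-exchange : ∀ {f : Subset n} {v a w} → w ≢ v → w ∈ f → w ∈ exchange f v a
∈-exchange {f = f} {v} {a} {w} w≢v w∈f with w Fin.≟ a
... | yes refl = lookup⇒[]= w _ (lookup∘update w (f [ v ]≔ outside) inside)
... | no w≢a   = lookup⇒[]= w _ (trans (lookup∘update′ w≢a (f [ v ]≔ outside) inside)
                   (trans (lookup∘update′ w≢v f outside) ([]=⇒lookup w∈f)))

a∈exchange : ∀ {f : Subset n} {v a} → a ∈ exchange f v a
a∈exchange {f = f} {v} {a} = lookup⇒[]= a _ (lookup∘update a (f [ v ]≔ outside) inside)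

-- Stellar subdivision of the edge uv of the complex with facets fs, with new vertex a.
module _ (u v a : Fin n) where

  subdivideFacet : Subset n → List (Subset n)
  subdivideFacet f with u ∈? f | v ∈? f
  ... | yes _ | yes _ = exchange f u a ∷ exchange f v a ∷ []
  ... | _     | _     = [ f ]

  subdivide : List (Subset n) → List (Subset n)
  subdivide = concatMap subdivideFacet

  Fresh : List (Subset n) → Set
  Fresh fs = u ≢ v × a ≢ u × a ≢ v × All (a ∉_) fs

  data Subdivided (f : Subset n) : Subset n → Set where
    kept      : u ∉ f ⊎ v ∉ f → Subdivided f f
    without-u : u ∈ f → v ∈ f → Subdivided f (exchange f u a)
    without-v : u ∈ f → v ∈ f → Subdivided f (exchange f v a)

  ∈-subdivideFacet⁻ : ∀ {f g} → g List.∈ subdivideFacet f → Subdivided f g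
  ∈-subdivideFacet⁻ {f} g∈ with u ∈? f | v ∈? f
  ∈-subdivideFacet⁻ (Any.here refl)             | yes u∈f | yes v∈f = without-u u∈f v∈f
  ∈-subdivideFacet⁻ (Any.there (Any.here refl)) | yes u∈f | yes v∈f = without-v u∈f v∈f
  ∈-subdivideFacet⁻ (Any.here refl)             | yes u∈f | no v∉f  = kept (inj₂ v∉f)
  ∈-subdivideFacet⁻ (Any.here refl)             | no u∉f  | _       = kept (inj₁ u∉f)

  ∈-subdivideFacet : ∀ {f g} → Subdivided f g → g List.∈ subdivideFacet f
  ∈-subdivideFacet {f} s with u ∈? f | v ∈? f | s
  ... | yes _   | yes _   | without-u _ _ = Any.here refl
  ... | yes _   | yes _   | without-v _ _ = Any.there (Any.here refl)
  ... | yes u∈f | yes _   | kept (inj₁ u∉f) = contradiction u∈f u∉f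
  ... | yes _   | yes v∈f | kept (inj₂ v∉f) = contradiction v∈f v∉f
  ... | yes _   | no _    | kept _ = Any.here refl
  ... | yes _   | no v∉f  | without-u _ v∈f = contradiction v∈f v∉f
  ... | yes _   | no v∉f  | without-v _ v∈f = contradiction v∈f v∉f
  ... | no _    | _       | kept _ = Any.here refl
  ... | no u∉f  | _       | without-u u∈f _ = contradiction u∈f u∉f
  ... | no u∉f  | _       | without-v u∈f _ = contradiction u∈f u∉f

  subdivided? : ∀ f → (u ∉ f ⊎ v ∉ f) ⊎ (u ∈ f × v ∈ f)
  subdivided? f with u ∈? f | v ∈? f
  ... | yes u∈f | yes v∈f = inj₂ (u∈f , v∈f)
  ... | yes _   | no v∉f  = inj₁ (inj₂ v∉f)
  ... | no u∉f  | _       = inj₁ (inj₁ u∉f)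

-- The homeomorphism induced by an edge subdivision

module StellarSubdivision (ℝ : Reals) {n} {u v a : Fin n} {fs : List (Subset n)} (fresh : Fresh u v a fs) where
  open Reals ℝ
  open Topology ℝ
  open OrderedField ℝ
  open Continuity ℝ
  open Homeomorphisms ℝ
  open Simplices ℝ
  open SemiringSum semiring using (sum-cong-≋; *-distribˡ-sum; ∑-distrib-+)

  private
    u≢v = proj₁ fresh
    a≢u = proj₁ (proj₂ fresh)
    a≢v = proj₁ (proj₂ (proj₂ fresh))

    a∉ : ∀ {f} → f List.∈ fs → a ∉ f
    a∉ = All.lookup (proj₂ (proj₂ (proj₂ fresh)))

  basis : ∀ {m} → Fin m → ℝ^ m
  basis i j with i Fin.≟ j
  ... | yes _ = 1#
  ... | no _  = 0#

  basis-same : ∀ {m} (i : Fin m) → basis i i ≈ 1#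
  basis-same i with i Fin.≟ i
  ... | yes _  = ≈-refl
  ... | no i≢i = contradiction refl i≢i

  basis-other : ∀ {m} {i j : Fin m} → i ≢ j → basis i j ≈ 0#
  basis-other {i = i} {j} i≢j with i Fin.≟ j
  ... | yes i≡j = contradiction i≡j i≢j
  ... | no _    = ≈-refl

  basis-suc : ∀ {m} (i j : Fin m) → basis (suc i) (suc j) ≈ basis i j
  basis-suc i j with i Fin.≟ j
  ... | yes _ = ≈-refl
  ... | no _  = ≈-refl

  sum-basis : ∀ {m} (i : Fin m) → sum (basis i) ≈ 1#
  sum-basis {ℕ.suc m} 0F      = ≈-trans (+-congˡ (sum-zero (λ j → basis {ℕ.suc m} 0F (suc j)) λ _ → ≈-refl)) (+-identityʳ 1#)
  sum-basis {ℕ.suc m} (suc i) = ≈-trans (+-identityˡ _)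
    (≈-trans (sum-cong-≋ {m} {λ j → basis (suc i) (suc j)} {basis i} (basis-suc i)) (sum-basis i))

  -- Twice the vector from the new vertex a to the midpoint of uv. Its coordinates sum to 0, so
  -- sliding along it preserves total mass.
  direction : ℝ^ n
  direction w = basis u w + basis v w + - (1# + 1#) * basis a w

  slide : Carrier → ℝ^ n → ℝ^ n
  slide s x w = x w + s * direction w

  sum-direction : sum direction ≈ 0#
  sum-direction = ≈-trans (∑-distrib-+ (λ w → basis u w + basis v w) (λ w → - (1# + 1#) * basis a w)) $
    ≈-trans (+-cong (≈-trans (∑-distrib-+ (basis u) (basis v)) (+-cong (sum-basis u) (sum-basis v)))
      (≈-trans (≈-sym (*-distribˡ-sum (- (1# + 1#)) (basis a))) (*-congˡ (sum-basis a)))) $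
    ≈-trans (+-congˡ (*-identityʳ _)) (-‿inverseʳ (1# + 1#))

  sum-slide : ∀ s x → sum (slide s x) ≈ sum x
  sum-slide s x = ≈-trans (∑-distrib-+ x (λ w → s * direction w)) $
    ≈-trans (+-congˡ (≈-trans (≈-sym (*-distribˡ-sum s direction)) (≈-trans (*-congˡ sum-direction) (zeroʳ s)))) $
    +-identityʳ _

  module _ (s : Carrier) (x : ℝ^ n) where

    slide-u : slide s x u ≈ x u + s
    slide-u = +-congˡ $ ≈-trans
      (*-congˡ (+-cong (+-cong (basis-same u) (basis-other (u≢v ∘ sym))) (*-congˡ (basis-other a≢u))))
      (solve 1 (λ s → s :* (con (+ 1) :+ con (+ 0) :+ :- (con (+ 1) :+ con (+ 1)) :* con (+ 0)) := s) ≈-refl s)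

    slide-v : slide s x v ≈ x v + s
    slide-v = +-congˡ $ ≈-trans
      (*-congˡ (+-cong (+-cong (basis-other u≢v) (basis-same v)) (*-congˡ (basis-other a≢v))))
      (solve 1 (λ s → s :* (con (+ 0) :+ con (+ 1) :+ :- (con (+ 1) :+ con (+ 1)) :* con (+ 0)) := s) ≈-refl s)

    slide-a : slide s x a ≈ x a + - (s + s)
    slide-a = +-congˡ $ ≈-trans
      (*-congˡ (+-cong (+-cong (basis-other (a≢u ∘ sym)) (basis-other (a≢v ∘ sym))) (*-congˡ (basis-same a))))
      (solve 1 (λ s → s :* (con (+ 0) :+ con (+ 0) :+ :- (con (+ 1) :+ con (+ 1)) :* con (+ 1)) := :- (s :+ s)) ≈-refl s)

    slide-other : ∀ {w} → w ≢ u → w ≢ v → w ≢ a → slide s x w ≈ x w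
    slide-other {w} w≢u w≢v w≢a = ≈-trans
      (+-congˡ (*-congˡ (+-cong (+-cong (basis-other (w≢u ∘ sym)) (basis-other (w≢v ∘ sym)))
                                (*-congˡ (basis-other (w≢a ∘ sym))))))
      (solve 2 (λ x s → x :+ s :* (con (+ 0) :+ con (+ 0) :+ :- (con (+ 1) :+ con (+ 1)) :* con (+ 0)) := x) ≈-refl (x w) s)

    slide-zero : s ≈ 0# → ∀ w → slide s x w ≈ x w
    slide-zero s≈0 w = ≈-trans (+-congˡ (≈-trans (*-congʳ s≈0) (zeroˡ _))) (+-identityʳ _)

    slide-nonneg : (∀ w → 0# ≤ x w) → 0# ≤ x u + s → 0# ≤ x v + s → 0# ≤ x a + - (s + s) →
                   ∀ w → 0# ≤ slide s x w
    slide-nonneg 0≤x 0≤u 0≤v 0≤a w with w Fin.≟ u | w Fin.≟ v | w Fin.≟ a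
    ... | yes refl | _        | _        = ≤-respʳ-≈ (≈-sym slide-u) 0≤u
    ... | no _     | yes refl | _        = ≤-respʳ-≈ (≈-sym slide-v) 0≤v
    ... | no _     | no _     | yes refl = ≤-respʳ-≈ (≈-sym slide-a) 0≤a
    ... | no w≢u   | no w≢v   | no w≢a   = ≤-respʳ-≈ (≈-sym (slide-other w≢u w≢v w≢a)) (0≤x w)

  slide-slide : ∀ {s t} x w → t ≈ - s → slide t (slide s x) w ≈ x w
  slide-slide {s} x w t≈-s = ≈-trans (+-congˡ (*-congʳ t≈-s))
    (solve 3 (λ x s d → x :+ s :* d :+ :- s :* d := x) ≈-refl (x w) s (direction w))

  -- A point with mass x a on the new vertex a, the midpoint of uv, gets that mass
  -- back in equal parts on u and v; conversely as much of the mass on u and v as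
  -- possible is moved to a.
  share : ℝ^ n → Carrier
  share x = ½ * x a

  gather : ℝ^ n → Carrier
  gather y = - y u ⊔ - y v

  private
    share-zero : ∀ {x} → x a ≈ 0# → share x ≈ 0#
    share-zero xa≈0 = ≈-trans (*-congˡ xa≈0) (zeroʳ ½)

    -nonneg≤0 : ∀ {r} → 0# ≤ r → - r ≤ 0#
    -nonneg≤0 0≤r = ≤-respʳ-≈ -0#≈0# (neg-mono-≤ 0≤r)

    gather≤0 : ∀ {y} → (∀ w → 0# ≤ y w) → gather y ≤ 0#
    gather≤0 0≤y = ⊔-lub (-nonneg≤0 (0≤y u)) (-nonneg≤0 (0≤y v))

    gather-zero : ∀ {y} → (∀ w → 0# ≤ y w) → y u ≈ 0# ⊎ y v ≈ 0# → gather y ≈ 0#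
    gather-zero {y} 0≤y (inj₁ yu≈0) = antisym (gather≤0 0≤y)
      (≤-respˡ-≈ (≈-trans (-‿cong yu≈0) -0#≈0#) (x≤x⊔y (- y u) (- y v)))
    gather-zero {y} 0≤y (inj₂ yv≈0) = antisym (gather≤0 0≤y)
      (≤-respˡ-≈ (≈-trans (-‿cong yv≈0) -0#≈0#) (y≤x⊔y (- y u) (- y v)))

    -r≤s⇒0≤r+s : ∀ {r s} → - r ≤ s → 0# ≤ r + s
    -r≤s⇒0≤r+s {r} {s} -r≤s = ≤-respʳ-≈ (solve 2 (λ r s → s :- :- r := r :+ s) ≈-refl r s) (x≤y⇒0≤y-x -r≤s)

    slide-share-a : ∀ x → slide (share x) x a ≈ 0#
    slide-share-a x = ≈-trans (slide-a (share x) x)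
      (≈-trans (+-congˡ (-‿cong (½x+½x (x a)))) (-‿inverseʳ (x a)))

    off-edge : ∀ {f w} → u ∈ f → v ∈ f → w ∉ f → w ≢ u × w ≢ v
    off-edge u∈f v∈f w∉f = (λ { refl → w∉f u∈f }) , (λ { refl → w∉f v∈f })

  -- A kept facet avoids a, so nothing moves. A facet obtained by splitting f passes its mass on a
  -- to u and v, which both lie in f.
  share-region : ∀ {x} → Supported (subdivide u v a fs) x → Supported fs (slide (share x) x)
  share-region {x} (0≤x , Σx≈1 , g , g∈ , x≈0) =
    slide-nonneg s x 0≤x (+-nonneg (0≤x u) 0≤s) (+-nonneg (0≤x v) 0≤s)
      (≤-reflexive (≈-sym (≈-trans (≈-sym (slide-a s x)) (slide-share-a x)))) ,
    ≈-trans (sum-slide s x) Σx≈1 ,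
    facet (List.find (∈-concatMap⁻ (subdivideFacet u v a) {xs = fs} g∈))
    where
    s = share x
    0≤s : 0# ≤ s
    0≤s = *-nonneg (proj₁ 0<½) (0≤x a)
    facet : ∃[ f ] f List.∈ fs × g List.∈ subdivideFacet u v a f →
            ∃[ f ] f List.∈ fs × (∀ w → w ∉ f → slide s x w ≈ 0#)
    facet (f , f∈fs , g∈f) = f , f∈fs , vanishes (∈-subdivideFacet⁻ u v a g∈f) x≈0
      where
      cone : ∀ {g} → u ∈ f → v ∈ f → (∀ {w} → w ∈ g → w ≡ a ⊎ w ∈ f) →
             (∀ w → w ∉ g → x w ≈ 0#) → ∀ w → w ∉ f → slide s x w ≈ 0#
      cone u∈f v∈f g⊆ x≈0 w w∉f with w Fin.≟ a
      ... | yes refl = slide-share-a x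
      ... | no w≢a   = let (w≢u , w≢v) = off-edge u∈f v∈f w∉f in
        ≈-trans (slide-other s x w≢u w≢v w≢a) (x≈0 w λ w∈g → excluded (g⊆ w∈g))
        where
        excluded : ¬ (w ≡ a ⊎ w ∈ f)
        excluded (inj₁ w≡a) = w≢a w≡a
        excluded (inj₂ w∈f) = w∉f w∈f
      weaken : ∀ {p w} → w ≡ a ⊎ (w ≢ p × w ∈ f) → w ≡ a ⊎ w ∈ f
      weaken (inj₁ w≡a)       = inj₁ w≡a
      weaken (inj₂ (_ , w∈f)) = inj₂ w∈f
      vanishes : ∀ {g} → Subdivided u v a f g → (∀ w → w ∉ g → x w ≈ 0#) → ∀ w → w ∉ f → slide s x w ≈ 0#
      vanishes (kept _) x≈0 w w∉f =
        ≈-trans (slide-zero s x (share-zero {x} (x≈0 a (a∉ f∈fs))) w) (x≈0 w w∉f)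
      vanishes (without-u u∈f v∈f) = cone u∈f v∈f (weaken ∘ ∈-exchange⁻)
      vanishes (without-v u∈f v∈f) = cone u∈f v∈f (weaken ∘ ∈-exchange⁻)

  -- The slide amount is minus the smaller of y u and y v, so afterwards u or v carries no mass. The
  -- new facet is f with that vertex replaced by a.
  gather-region : ∀ {y} → Supported fs y → Supported (subdivide u v a fs) (slide (gather y) y)
  gather-region {y} (0≤y , Σy≈1 , f , f∈fs , y≈0) =
    slide-nonneg s y 0≤y (-r≤s⇒0≤r+s (x≤x⊔y (- y u) (- y v))) (-r≤s⇒0≤r+s (y≤x⊔y (- y u) (- y v)))
      (+-nonneg (0≤y a) (≤-respʳ-≈ (solve 1 (λ s → :- s :+ :- s := :- (s :+ s)) ≈-refl s) (+-nonneg 0≤-s 0≤-s))) ,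
    ≈-trans (sum-slide s y) Σy≈1 , facet (subdivided? u v a f)
    where
    s = gather y
    0≤-s : 0# ≤ - s
    0≤-s = ≤-respˡ-≈ -0#≈0# (neg-mono-≤ (gather≤0 0≤y))
    found : ∀ {g} → Subdivided u v a f g → g List.∈ subdivide u v a fs
    found sub = ∈-concatMap⁺ (subdivideFacet u v a) (List.lose f∈fs (∈-subdivideFacet u v a sub))
    zero-at : ∀ {r} → s ≈ - r → r + s ≈ 0#
    zero-at {r} s≈-r = ≈-trans (+-congˡ s≈-r) (-‿inverseʳ r)
    cone : ∀ {p} → u ∈ f → v ∈ f → slide s y p ≈ 0# →
           ∀ w → w ∉ exchange f p a → slide s y w ≈ 0#
    cone {p} u∈f v∈f p≈0 w w∉ with w Fin.≟ p
    ... | yes refl = p≈0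
    ... | no w≢p   = let w∉f = λ w∈f → w∉ (∈-exchange w≢p w∈f) ; (w≢u , w≢v) = off-edge u∈f v∈f w∉f in
      ≈-trans (slide-other s y w≢u w≢v (λ { refl → w∉ a∈exchange })) (y≈0 w w∉f)
    vanish : u ∉ f ⊎ v ∉ f → y u ≈ 0# ⊎ y v ≈ 0#
    vanish (inj₁ u∉f) = inj₁ (y≈0 u u∉f)
    vanish (inj₂ v∉f) = inj₂ (y≈0 v v∉f)
    facet : (u ∉ f ⊎ v ∉ f) ⊎ (u ∈ f × v ∈ f) →
            ∃[ g ] g List.∈ subdivide u v a fs × (∀ w → w ∉ g → slide s y w ≈ 0#)
    facet (inj₁ off) = f , found (kept off) , λ w w∉f →
      ≈-trans (slide-zero s y (gather-zero 0≤y (vanish off)) w) (y≈0 w w∉f)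
    facet (inj₂ (u∈f , v∈f)) with ⊔-sel (- y u) (- y v)
    ... | inj₁ s≈-yu = exchange f u a , found (without-u u∈f v∈f) ,
                       cone u∈f v∈f (≈-trans (slide-u s y) (zero-at s≈-yu))
    ... | inj₂ s≈-yv = exchange f v a , found (without-v u∈f v∈f) ,
                       cone u∈f v∈f (≈-trans (slide-v s y) (zero-at s≈-yv))

  -- No facet of the subdivision contains both u and v, so the smaller of the masses x u and x v is
  -- 0. After sharing it is exactly the amount shared.
  gather-share : ∀ {x} → Supported (subdivide u v a fs) x → gather (slide (share x) x) ≈ - share x
  gather-share {x} (0≤x , _ , g , g∈ , x≈0) = antisym (⊔-lub upper-u upper-v) (lower one-zero)
    where
    s = share x
    -[r+s]≤-s : ∀ {r} → 0# ≤ r → - (r + s) ≤ - s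
    -[r+s]≤-s {r} 0≤r = ≤-from 0≤r (solve 2 (λ r s → r := :- s :- :- (r :+ s)) ≈-refl r s)
    upper-u : - slide s x u ≤ - s
    upper-u = ≤-respˡ-≈ (-‿cong (≈-sym (slide-u s x))) (-[r+s]≤-s (0≤x u))
    upper-v : - slide s x v ≤ - s
    upper-v = ≤-respˡ-≈ (-‿cong (≈-sym (slide-v s x))) (-[r+s]≤-s (0≤x v))
    zero-on-edge : ∀ {f} → Subdivided u v a f g → u ∉ g ⊎ v ∉ g
    zero-on-edge (kept off) = off
    zero-on-edge (without-u _ _) = inj₁ λ u∈ → excluded (∈-exchange⁻ u∈)
      where
      excluded : ∀ {A : Set} → ¬ (u ≡ a ⊎ (u ≢ u × A))
      excluded (inj₁ u≡a)       = a≢u (sym u≡a)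
      excluded (inj₂ (u≢u , _)) = u≢u refl
    zero-on-edge (without-v _ _) = inj₂ λ v∈ → excluded (∈-exchange⁻ v∈)
      where
      excluded : ∀ {A : Set} → ¬ (v ≡ a ⊎ (v ≢ v × A))
      excluded (inj₁ v≡a)       = a≢v (sym v≡a)
      excluded (inj₂ (v≢v , _)) = v≢v refl
    one-zero : u ∉ g ⊎ v ∉ g
    one-zero = let (_ , _ , g∈f) = List.find (∈-concatMap⁻ (subdivideFacet u v a) {xs = fs} g∈) in
      zero-on-edge (∈-subdivideFacet⁻ u v a g∈f)
    0+s : ∀ {r} → r ≈ 0# → - (r + s) ≈ - s
    0+s r≈0 = -‿cong (≈-trans (+-congʳ r≈0) (+-identityˡ s))
    lower : u ∉ g ⊎ v ∉ g → - s ≤ gather (slide s x)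
    lower (inj₁ u∉g) = ≤-respˡ-≈ (≈-trans (-‿cong (slide-u s x)) (0+s (x≈0 u u∉g))) (x≤x⊔y (- slide s x u) (- slide s x v))
    lower (inj₂ v∉g) = ≤-respˡ-≈ (≈-trans (-‿cong (slide-v s x)) (0+s (x≈0 v v∉g))) (y≤x⊔y (- slide s x u) (- slide s x v))

  -- As a lies in no facet of `fs`, y a = 0, and gathering by s puts mass - 2 s on a.
  share-gather : ∀ {y} → Supported fs y → share (slide (gather y) y) ≈ - gather y
  share-gather {y} (_ , _ , f , f∈fs , y≈0) = ≈-trans
    (*-congˡ (≈-trans (slide-a s y) (+-congʳ (y≈0 a (a∉ f∈fs)))))
    (≈-trans (solve 2 (λ h s → h :* (con (+ 0) :+ :- (s :+ s)) := :- (h :* s :+ h :* s)) ≈-refl ½ s) (-‿cong (½x+½x s)))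
    where s = gather y

  stellar≃ : Supported (subdivide u v a fs) ≃ Supported fs
  stellar≃ = record
    { to = λ x → slide (share x) x ; from = λ y → slide (gather y) y
    ; to-region = share-region ; from-region = gather-region
    ; from-to = λ {x} Sx w → slide-slide x w (gather-share Sx)
    ; to-from = λ {y} Sy w → slide-slide y w (share-gather Sy)
    ; to-continuous = λ _ → continuous-map n λ w → continuous-+ (continuous-coordinate w)
        (continuous-* (continuous-* (continuous-const ½) (continuous-coordinate a)) (continuous-const (direction w)))
    ; from-continuous = λ _ → continuous-map n λ w → continuous-+ (continuous-coordinate w)
        (continuous-* (continuous-⊔ (continuous-neg (continuous-coordinate u)) (continuous-neg (continuous-coordinate v)))
          (continuous-const (direction w))) }

-- Complexes generated by facets, and certified chains of moves

_∈ˡ?_ : (f : Subset n) (fs : List (Subset n)) → Dec (f List.∈ fs)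
_∈ˡ?_ = DecMembership._∈?_ _≟ˢ_

generated : List (Subset n) → Complex n
generated fs = record
  { Face        = λ τ → Nonempty τ × Any (τ ⊆_) fs
  ; face?       = λ τ → nonempty? τ ×-dec any? (τ ⊆?_) fs
  ; nonempty    = proj₁
  ; down-closed = λ (_ , below) ρ⊆τ ρ≠∅ → ρ≠∅ , Any.map (⊆-trans ρ⊆τ) below }

module _ (ℝ : Reals) where
  open Reals ℝ using (_≈_; 0#; 1#; 0≉1; sum)
  open Topology ℝ
  open OrderedField ℝ
  open Homeomorphisms ℝ
  open Simplices ℝ

  Realization≃Supported : (fs : List (Subset n)) → Realization (generated fs) ≃ Supported fs
  Realization≃Supported fs = ≃-identity
    (λ (0≤x , Σx≈1 , σ , (_ , below) , x≈0) →
      let (f , f∈fs , σ⊆f) = List.find below in 0≤x , Σx≈1 , f , f∈fs , λ v v∉f → x≈0 v (v∉f ∘ σ⊆f))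
    (λ (0≤x , Σx≈1 , f , f∈fs , x≈0) →
      0≤x , Σx≈1 , f , (inhabited Σx≈1 x≈0 , List.lose f∈fs ⊆-refl) , x≈0)
    where
    -- A listed set might be empty, whereas faces are not; total mass 1 rules this out for a
    -- supporting set.
    inhabited : ∀ {f x} → sum x ≈ 1# → (∀ v → v ∉ f → x v ≈ 0#) → Nonempty f
    inhabited {f} {x} Σx≈1 x≈0 with nonempty? f
    ... | yes f≠∅ = f≠∅
    ... | no f≡∅  = contradiction
      (≈-trans (≈-sym (sum-zero x λ v → x≈0 v λ v∈f → f≡∅ (v , v∈f))) Σx≈1) 0≉1

infix 4 _⊑_

_⊑_ : List (Subset n) → List (Subset n) → Set
fs ⊑ gs = All (List._∈ gs) fs

_⊑?_ : (fs gs : List (Subset n)) → Dec (fs ⊑ gs)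
fs ⊑? gs = all? (_∈ˡ? gs) fs

fresh? : ∀ (u v a : Fin n) fs → Dec (Fresh u v a fs)
fresh? u v a fs = ¬? (u Fin.≟ v) ×-dec ¬? (a Fin.≟ u) ×-dec ¬? (a Fin.≟ v) ×-dec all? (λ f → ¬? (a ∈? f)) fs

data Move (n : ℕ) : Set where
  subdivision weld : (u v a : Fin n) → Move n

-- The only possible facets of a complex whose subdivision at uv with new vertex a has facets fs.
welded : (u v a : Fin n) → List (Subset n) → List (Subset n)
welded u v a fs =
  filter (λ f → ¬? (a ∈? f)) fs ++ map (λ f → exchange f a v) (filter (λ f → a ∈? f ×-dec u ∈? f) fs)

mutual
  Connects : List (Move n) → List (Subset n) → List (Subset n) → Set
  Connects []                          fs gs = fs ⊑ gs × gs ⊑ fs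
  Connects (subdivision u v a ∷ moves) fs gs = Fresh u v a fs × Connects moves (subdivide u v a fs) gs
  Connects (weld u v a ∷ moves)        fs gs = ConnectsVia u v a moves fs (welded u v a fs) gs

  -- The candidate `hs` is not proved right in general: it is subdivided again and compared with
  -- `fs` as a set. It is a separate argument because several conditions share it.
  ConnectsVia : (u v a : Fin n) → List (Move n) → (fs hs gs : List (Subset n)) → Set
  ConnectsVia u v a moves fs hs gs =
    Fresh u v a hs × fs ⊑ subdivide u v a hs × subdivide u v a hs ⊑ fs × Connects moves hs gs

mutual
  connects? : ∀ (moves : List (Move n)) fs gs → Dec (Connects moves fs gs)
  connects? []                          fs gs = fs ⊑? gs ×-dec gs ⊑? fs
  connects? (subdivision u v a ∷ moves) fs gs = fresh? u v a fs ×-dec connects? moves (subdivide u v a fs) gs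
  connects? (weld u v a ∷ moves)        fs gs = connectsVia? u v a moves fs (welded u v a fs) gs

  connectsVia? : ∀ (u v a : Fin n) moves fs hs gs → Dec (ConnectsVia u v a moves fs hs gs)
  connectsVia? u v a moves fs hs gs =
    fresh? u v a hs ×-dec fs ⊑? subdivide u v a hs ×-dec subdivide u v a hs ⊑? fs ×-dec connects? moves hs gs

module _ (ℝ : Reals) where
  open Homeomorphisms ℝ
  open Simplices ℝ
  open StellarSubdivision ℝ using (stellar≃)

  ⊑⇒≃ : {fs gs : List (Subset n)} → fs ⊑ gs → gs ⊑ fs → Supported fs ≃ Supported gs
  ⊑⇒≃ fs⊑gs gs⊑fs = ≃-identity
    (λ (0≤x , Σx≈1 , f , f∈fs , x≈0) → 0≤x , Σx≈1 , f , All.lookup fs⊑gs f∈fs , x≈0)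
    (λ (0≤x , Σx≈1 , g , g∈gs , x≈0) → 0≤x , Σx≈1 , g , All.lookup gs⊑fs g∈gs , x≈0)

  connects⇒≃ : ∀ (moves : List (Move n)) {fs gs} → Connects moves fs gs → Supported fs ≃ Supported gs
  connects⇒≃ [] (fs⊑gs , gs⊑fs) = ⊑⇒≃ fs⊑gs gs⊑fs
  connects⇒≃ (subdivision u v a ∷ moves) (fresh , rest) =
    ≃-trans (≃-sym (stellar≃ fresh)) (connects⇒≃ moves rest)
  connects⇒≃ (weld u v a ∷ moves) (fresh , fs⊑ , ⊑fs , rest) =
    ≃-trans (⊑⇒≃ fs⊑ ⊑fs) (≃-trans (stellar≃ fresh) (connects⇒≃ moves rest))

-- `True` turns the evaluated decision into the proof, so the list of moves is the whole
-- certificate, and one evaluation serves every `Reals`.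
connects-simplex⇒SimplicialBall : ∀ {k} {fs : List (Subset (4 ℕ.+ k))} moves →
  True (connects? moves fs [ fullSimplex k ]) → SimplicialBall 3 (generated fs)
connects-simplex⇒SimplicialBall {k} {fs} moves connects ℝ = ≃⇒Homeomorphism
  (≃-trans (Realization≃Supported ℝ fs) (≃-trans (connects⇒≃ ℝ moves (toWitness connects)) (simplex≃Ball k)))
  where
  open Homeomorphisms ℝ
  open Simplices ℝ

-- Certified collapses

subsets : Subset n → List (Subset n)
subsets []            = [ [] ]
subsets (inside ∷ f)  = map (inside ∷_) (subsets f) ++ map (outside ∷_) (subsets f)
subsets (outside ∷ f) = map (outside ∷_) (subsets f)

∈-subsets : {τ f : Subset n} → τ ⊆ f → τ List.∈ subsets f
∈-subsets {τ = []}          {[]}          _   = Any.here refl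
∈-subsets {τ = inside ∷ τ}  {inside ∷ f}  τ⊆f = ∈-++⁺ˡ (∈-map⁺ (inside ∷_) (∈-subsets (drop-∷-⊆ τ⊆f)))
∈-subsets {τ = outside ∷ τ} {inside ∷ f}  τ⊆f =
  ∈-++⁺ʳ (map (inside ∷_) (subsets f)) (∈-map⁺ (outside ∷_) (∈-subsets (drop-∷-⊆ τ⊆f)))
∈-subsets {τ = inside ∷ τ}  {outside ∷ f} τ⊆f = contradiction (τ⊆f here) λ ()
∈-subsets {τ = outside ∷ τ} {outside ∷ f} τ⊆f = ∈-map⁺ (outside ∷_) (∈-subsets (drop-∷-⊆ τ⊆f))

facetSubsets : List (Subset n) → List (Subset n)
facetSubsets = concatMap subsets

face∈facetSubsets : ∀ {fs : List (Subset n)} {τ} → Face (generated fs) τ → τ List.∈ facetSubsets fs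
face∈facetSubsets (_ , below) = ∈-concatMap⁺ subsets (Any.map ∈-subsets below)

FreePair : Subset n → Subset n → List (Subset n) → Set
FreePair σ τ fs = σ List.∈ fs × τ List.∈ fs × ∣ τ ∣ ≡ ℕ.suc ∣ σ ∣ × σ ⊂ τ ×
                  All (λ ρ → σ ⊆ ρ → ρ ≡ σ ⊎ ρ ≡ τ) fs

freePair? : ∀ (σ τ : Subset n) fs → Dec (FreePair σ τ fs)
freePair? σ τ fs = σ ∈ˡ? fs ×-dec τ ∈ˡ? fs ×-dec ∣ τ ∣ ℕ.≟ ℕ.suc ∣ σ ∣ ×-dec σ ⊂? τ ×-dec
                   all? (λ ρ → σ ⊆? ρ →-dec (ρ ≟ˢ σ ⊎-dec ρ ≟ˢ τ)) fs

distinctFrom? : ∀ (σ τ : Subset n) → Decidable (λ ρ → ρ ≢ σ × ρ ≢ τ)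
distinctFrom? σ τ ρ = ¬? (ρ ≟ˢ σ) ×-dec ¬? (ρ ≟ˢ τ)

CollapsesTo : Fin n → List (Subset n × Subset n) → List (Subset n) → Set
CollapsesTo v []                fs = fs ⊑ [ ⁅ v ⁆ ] × ⁅ v ⁆ List.∈ fs
CollapsesTo v ((σ , τ) ∷ pairs) fs = FreePair σ τ fs × CollapsesTo v pairs (filter (distinctFrom? σ τ) fs)

collapsesTo? : ∀ (v : Fin n) pairs fs → Dec (CollapsesTo v pairs fs)
collapsesTo? v []                fs = fs ⊑? [ ⁅ v ⁆ ] ×-dec ⁅ v ⁆ ∈ˡ? fs
collapsesTo? v ((σ , τ) ∷ pairs) fs = freePair? σ τ fs ×-dec collapsesTo? v pairs (filter (distinctFrom? σ τ) fs)

-- Ties each intermediate complex, a nested face predicate, to the list on which freeness is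
-- decided.
Lists : Complex n → List (Subset n) → Set
Lists K fs = ∀ ρ → Face K ρ ⇔ ρ List.∈ fs

module _ {K : Complex n} {fs} (lists : Lists K fs) {σ τ} (free : FreePair σ τ fs) where
  private
    σ⊂τ = proj₁ (proj₂ (proj₂ (proj₂ free)))

    above : ∀ {ρ} → Face K ρ → σ ⊆ ρ → ρ ≡ σ ⊎ ρ ≡ τ
    above {ρ} Kρ = All.lookup (proj₂ (proj₂ (proj₂ (proj₂ free)))) (Equivalence.to (lists ρ) Kρ)

  -- A face containing σ or τ contains σ, hence is σ or τ by freeness. So removing the pair leaves a
  -- complex.
  collapsed : Complex n
  collapsed = record
    { Face        = λ ρ → Face K ρ × ρ ≢ σ × ρ ≢ τ
    ; face?       = λ ρ → face? K ρ ×-dec distinctFrom? σ τ ρ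
    ; nonempty    = nonempty K ∘ proj₁
    ; down-closed = λ (Kρ , ρ≢σ , ρ≢τ) π⊆ρ π≠∅ →
        down-closed K Kρ π⊆ρ π≠∅ ,
        (λ { refl → [ ρ≢σ , ρ≢τ ]′ (above Kρ π⊆ρ) }) ,
        (λ { refl → [ ρ≢σ , ρ≢τ ]′ (above Kρ (⊆-trans (proj₁ σ⊂τ) π⊆ρ)) }) }

  lists-collapsed : Lists collapsed (filter (distinctFrom? σ τ) fs)
  lists-collapsed ρ = mk⇔
    (λ (Kρ , distinct) → ∈-filter⁺ (distinctFrom? σ τ) (Equivalence.to (lists ρ) Kρ) distinct)
    (λ ρ∈ → let (ρ∈fs , distinct) = ∈-filter⁻ (distinctFrom? σ τ) {xs = fs} ρ∈ in
      Equivalence.from (lists ρ) ρ∈fs , distinct)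

  collapse : K ↘ᵉ collapsed
  collapse = σ , τ , Equivalence.from (lists σ) (proj₁ free) , Equivalence.from (lists τ) (proj₁ (proj₂ free)) ,
    proj₁ (proj₂ (proj₂ free)) , σ⊂τ ,
    (λ Kρ σ⊂ρ → [ (λ { refl → contradiction σ⊂ρ (⊂-irref refl) }) , (λ ρ≡τ → ρ≡τ) ]′ (above Kρ (proj₁ σ⊂ρ))) ,
    λ ρ → mk⇔ (λ face → face) (λ face → face)

collapsesTo⇒↘ : ∀ (v : Fin n) pairs K {fs} → Lists K fs → CollapsesTo v pairs fs → K ↘ point v
collapsesTo⇒↘ v [] K lists (fs⊑ , v∈fs) = K , Star.ε , λ ρ → mk⇔
  (λ Kρ → singleton (All.lookup fs⊑ (Equivalence.to (lists ρ) Kρ)))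
  (λ { refl → Equivalence.from (lists ρ) v∈fs })
  where
  singleton : ∀ {ρ π : Subset _} → ρ List.∈ [ π ] → ρ ≡ π
  singleton (Any.here ρ≡π) = ρ≡π
collapsesTo⇒↘ v ((σ , τ) ∷ pairs) K {fs} lists (free , rest) =
  let (M , steps , M≐v) = collapsesTo⇒↘ v pairs (collapsed {K = K} {fs} lists free)
                              (lists-collapsed {K = K} {fs} lists free) rest in
  M , collapse {K = K} {fs} lists free ◅ steps , M≐v

faces : List (Subset n) → List (Subset n)
faces fs = filter (face? (generated fs)) (facetSubsets fs)

lists-faces : (fs : List (Subset n)) → Lists (generated fs) (faces fs)
lists-faces fs ρ = mk⇔
  (λ face → ∈-filter⁺ (face? (generated fs)) (face∈facetSubsets face) face)
  (λ ρ∈ → proj₂ (∈-filter⁻ (face? (generated fs)) {xs = facetSubsets fs} ρ∈))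

-- The obstruction to collapsing

-- If no triangle has exactly one edge in U, then an elementary expansion can only add a first
-- edge of U together with one of its end points.
module _ {B : Complex n} (U : Pred (Subset n) 0ℓ)
  (U-nonempty : ∀ {e} → U e → Nonempty e) (U-edge : ∀ {e} → U e → ∣ e ∣ ≡ 2)
  (another : ∀ {e τ} → U e → Face B τ → ∣ τ ∣ ≡ 3 → e ⊆ τ → ∃[ e′ ] U e′ × e′ ≢ e × e′ ⊆ τ)
  where

  ↘ᵉ⇒⊆ : ∀ {K L : Complex n} {ρ} → K ↘ᵉ L → Face L ρ → Face K ρ
  ↘ᵉ⇒⊆ (_ , _ , _ , _ , _ , _ , _ , faces) Lρ = proj₁ (Equivalence.to (faces _) Lρ)

  ↘⇒⊆ : ∀ {K L : Complex n} {ρ} → Star _↘ᵉ_ K L → Face L ρ → Face K ρ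
  ↘⇒⊆ Star.ε Lρ = Lρ
  ↘⇒⊆ (_◅_ {i = K} {j = K₁} step steps) Lρ = ↘ᵉ⇒⊆ {K} {K₁} step (↘⇒⊆ steps Lρ)

  never-collapsed : ∀ {K L : Complex n} → Star _↘ᵉ_ K L → (∀ {ρ} → Face K ρ → Face B ρ) →
    (∀ {e σ} → U e → σ ⊆ e → ∣ σ ∣ ≡ 1 → Face L σ) → (∀ {e} → U e → ¬ Face L e) →
    ∀ {e} → U e → ¬ Face K e
  never-collapsed Star.ε K⊆B ends avoids = avoids
  never-collapsed {K} {L} (_◅_ {j = K₁} step@(σ , τ , Kσ , Kτ , τ-dim , σ⊂τ , _ , faces) steps) K⊆B ends avoids {e} Ue Ke
    with e ≟ˢ σ | e ≟ˢ τ
  ... | no e≢σ | no e≢τ = removed Ue (Equivalence.from (faces e) (Ke , e≢σ , e≢τ))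
    where
    removed : ∀ {e} → U e → ¬ Face K₁ e
    removed = never-collapsed {K₁} steps (K⊆B ∘ ↘ᵉ⇒⊆ {K} {K₁} step) ends avoids
  -- Here e is the free face and τ a triangle. A second edge of U in τ survives the step, since its
  -- size differs from that of τ, and the later complexes contain no edge of U.
  ... | yes refl | _ =
    let (e′ , Ue′ , e′≢e , e′⊆τ) = another Ue (K⊆B Kτ) (trans τ-dim (cong ℕ.suc (U-edge Ue))) (proj₁ σ⊂τ) in
    never-collapsed {K₁} steps (K⊆B ∘ ↘ᵉ⇒⊆ {K} {K₁} step) ends avoids Ue′
      (Equivalence.from (faces e′) (down-closed K Kτ e′⊆τ (U-nonempty Ue′) , e′≢e , λ e′≡τ → ℕ.1+n≢n
        (trans (sym τ-dim) (trans (cong ∣_∣ (sym e′≡τ)) (trans (U-edge Ue′) (sym (U-edge Ue)))))))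
  -- Here e is removed together with its end point σ, yet σ persists into the target L.
  ... | no _ | yes refl = proj₁ (proj₂ (Equivalence.to (faces σ)
    (↘⇒⊆ steps (ends Ue (proj₁ σ⊂τ) (ℕ.suc-injective (trans (sym τ-dim) (U-edge Ue))))))) refl

⊆-card : ∀ {p q : Subset n} → p ⊆ q → ∣ p ∣ ≡ ∣ q ∣ → p ≡ q
⊆-card {p = []}          {[]}          _   _  = refl
⊆-card {p = inside ∷ p}  {inside ∷ q}  p⊆q eq = cong (inside ∷_) (⊆-card (drop-∷-⊆ p⊆q) (ℕ.suc-injective eq))
⊆-card {p = inside ∷ p}  {outside ∷ q} p⊆q eq = contradiction (p⊆q here) λ ()
⊆-card {p = outside ∷ p} {inside ∷ q}  p⊆q eq = contradiction eq (ℕ.<⇒≢ (ℕ.s≤s (p⊆q⇒∣p∣≤∣q∣ (drop-∷-⊆ p⊆q))))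
⊆-card {p = outside ∷ p} {outside ∷ q} p⊆q eq = cong (outside ∷_) (⊆-card (drop-∷-⊆ p⊆q) eq)

card≡1⇒nonempty : (p : Subset n) → ∣ p ∣ ≡ 1 → Nonempty p
card≡1⇒nonempty {n} p ∣p∣≡1 with nonempty? p
... | yes p≠∅ = p≠∅
... | no p≡∅  = contradiction (trans (sym ∣p∣≡1) (trans (cong ∣_∣ (Empty-unique p≡∅)) (∣⊥∣≡0 n))) λ ()

InteriorTriangle : List (Subset n) → Subset n → Set
InteriorTriangle fs τ = Any (λ f → τ ⊆ f × Any (λ g → τ ⊆ g × f ≢ g) fs) fs

interiorTriangle? : ∀ fs → Decidable (InteriorTriangle {n} fs)
interiorTriangle? fs τ = any? (λ f → τ ⊆? f ×-dec any? (λ g → τ ⊆? g ×-dec ¬? (f ≟ˢ g)) fs) fs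

BoundaryTriangle : List (Subset n) → Subset n → Set
BoundaryTriangle fs τ = ∣ τ ∣ ≡ 3 × Any (λ f → τ ⊆ f × All (λ g → τ ⊆ g → f ≡ g) fs) fs

boundaryTriangle? : ∀ fs → Decidable (BoundaryTriangle {n} fs)
boundaryTriangle? fs τ = ∣ τ ∣ ℕ.≟ 3 ×-dec
  any? (λ f → τ ⊆? f ×-dec all? (λ g → τ ⊆? g →-dec (f ≟ˢ g)) fs) fs

-- The field `triangles` serves twice. Interior triangles keep the edges of U off the boundary, and
-- the second edge of U is what blocks the collapse. The field `end-points` ensures that the target
-- retains the vertices of these edges.
record Obstructs (fs U : List (Subset n)) : Set where
  constructor obstructs
  field
    tetrahedra : All (λ f → ∣ f ∣ ≡ 4) fs
    edges      : All (λ e → ∣ e ∣ ≡ 2 × Face (generated fs) e) U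
    triangles  : All (λ τ → ∣ τ ∣ ≡ 3 → All (λ e → e ⊆ τ →
                   InteriorTriangle fs τ × Any (λ e′ → e′ ≢ e × e′ ⊆ τ) U) U) (facetSubsets fs)
    end-points : All (λ e → All (λ σ → ∣ σ ∣ ≡ 1 →
                   Any (λ τ → σ ⊆ τ × BoundaryTriangle fs τ) (facetSubsets fs)) (subsets e)) U

obstructs? : ∀ (fs U : List (Subset n)) → Dec (Obstructs fs U)
obstructs? fs U = map′ (λ (t , e , τ , p) → obstructs t e τ p) (λ (obstructs t e τ p) → t , e , τ , p)
  (all? (λ f → ∣ f ∣ ℕ.≟ 4) fs ×-dec
   all? (λ e → ∣ e ∣ ℕ.≟ 2 ×-dec face? (generated fs) e) U ×-dec
   all? (λ τ → ∣ τ ∣ ℕ.≟ 3 →-dec all? (λ e → e ⊆? τ →-dec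
     (interiorTriangle? fs τ ×-dec any? (λ e′ → ¬? (e′ ≟ˢ e) ×-dec e′ ⊆? τ) U)) U) (facetSubsets fs) ×-dec
   all? (λ e → all? (λ σ → ∣ σ ∣ ℕ.≟ 1 →-dec
     any? (λ τ → σ ⊆? τ ×-dec boundaryTriangle? fs τ) (facetSubsets fs)) (subsets e)) U)

module _ {fs U : List (Subset n)} (obstruction : Obstructs fs U) where
  open Obstructs obstruction

  private
    B = generated fs

    facet-face : ∀ {τ f} → Face B τ → f List.∈ fs → τ ⊆ f → FaceOfDim B 3 f
    facet-face Bτ f∈fs τ⊆f =
      ((proj₁ (proj₁ Bτ) , τ⊆f (proj₂ (proj₁ Bτ))) , List.lose f∈fs ⊆-refl) , All.lookup tetrahedra f∈fs

    interior⇒¬boundary : ∀ {τ} → Face B τ → InteriorTriangle fs τ → ¬ BoundaryFacet B 2 τ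
    interior⇒¬boundary Bτ interior (_ , _ , _ , unique) =
      let (f , f∈fs , τ⊆f , others) = List.find interior ; (g , g∈fs , τ⊆g , f≢g) = List.find others in
      f≢g (trans (sym (unique (facet-face Bτ f∈fs τ⊆f , τ⊆f))) (unique (facet-face Bτ g∈fs τ⊆g , τ⊆g)))

    tetrahedron∈fs : ∀ {τ} → FaceOfDim B 3 τ → τ List.∈ fs
    tetrahedron∈fs ((_ , below) , ∣τ∣≡4) =
      let (f , f∈fs , τ⊆f) = List.find below in
      subst (List._∈ fs) (sym (⊆-card τ⊆f (trans ∣τ∣≡4 (sym (All.lookup tetrahedra f∈fs))))) f∈fs

    boundary : ∀ {τ σ} → Nonempty σ → σ ⊆ τ → BoundaryTriangle fs τ → BoundaryFacet B 2 τ
    boundary {τ} (x , x∈σ) σ⊆τ (∣τ∣≡3 , once) =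
      let (f , f∈fs , τ⊆f , only) = List.find once in
      (Bτ , ∣τ∣≡3) , f , (facet-face Bτ f∈fs τ⊆f , τ⊆f) ,
      λ (g-face , τ⊆g) → All.lookup only (tetrahedron∈fs g-face) τ⊆g
      where
      Bτ : Face B τ
      Bτ = (x , σ⊆τ x∈σ) , Any.map proj₁ once

  obstructs⇒¬↘ : ∀ {e} → e List.∈ U → (σ : Subset n) (σ-facet : Facet (∂ 2 B) σ) → ¬ (B ↘ (∂ 2 B ∖ (σ , σ-facet)))
  obstructs⇒¬↘ e∈U σ (_ , maximal) (M , steps , M≐∂∖σ) = never-collapsed {B = B} (List._∈ U)
    (λ e∈U → proj₁ (proj₂ (All.lookup edges e∈U))) (proj₁ ∘ All.lookup edges)
    (λ e∈U Bτ ∣τ∣≡3 e⊆τ →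
      let (e′ , e′∈U , e′≢e , e′⊆τ) = List.find (proj₂ (at-triangle e∈U Bτ ∣τ∣≡3 e⊆τ)) in e′ , e′∈U , e′≢e , e′⊆τ)
    steps (λ Bρ → Bρ) ends
    -- A face of the target lies in a boundary triangle, but every triangle on e is interior.
    (λ e∈U Me → let ((_ , τ , τ-boundary , e⊆τ) , _) = Equivalence.to (M≐∂∖σ _) Me
                    ((Bτ , ∣τ∣≡3) , _) = τ-boundary in
      interior⇒¬boundary Bτ (proj₁ (at-triangle e∈U Bτ ∣τ∣≡3 e⊆τ)) τ-boundary)
    e∈U (proj₂ (All.lookup edges e∈U))
    where
    at-triangle : ∀ {e τ} → e List.∈ U → Face B τ → ∣ τ ∣ ≡ 3 → e ⊆ τ →
                  InteriorTriangle fs τ × Any (λ e′ → e′ ≢ e × e′ ⊆ τ) U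
    at-triangle e∈U Bτ ∣τ∣≡3 = All.lookup (All.lookup triangles (face∈facetSubsets Bτ) ∣τ∣≡3) e∈U
    ends : ∀ {e ρ} → e List.∈ U → ρ ⊆ e → ∣ ρ ∣ ≡ 1 → Face M ρ
    ends {e} {ρ} e∈U ρ⊆e ∣ρ∣≡1 =
      let (τ , _ , ρ⊆τ , τ-boundary) = List.find (All.lookup (All.lookup end-points e∈U) (∈-subsets ρ⊆e) ∣ρ∣≡1)
          ρ≠∅ = card≡1⇒nonempty ρ ∣ρ∣≡1
          τ-facet = boundary ρ≠∅ ρ⊆τ τ-boundary in
      -- If the end point were the removed facet σ, maximality would identify it with the boundary
      -- triangle τ, which has three vertices.
      Equivalence.from (M≐∂∖σ ρ) ((ρ≠∅ , τ , τ-facet , ρ⊆τ) , λ { refl →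
        contradiction (trans (sym (proj₁ τ-boundary)) (trans (cong ∣_∣
          (maximal ((proj₁ ρ≠∅ , ρ⊆τ (proj₂ ρ≠∅)) , τ , τ-facet , ⊆-refl) ρ⊆τ)) ∣ρ∣≡1)) λ () })

-- The ball and its certificates

-- The labels 12 and 13 are not vertices of B; they are needed for the subdivisions.
label : ℕ → Fin 14
label k = k mod 14

vertices : List ℕ → Subset 14
vertices = foldr (λ k σ → σ [ label k ]≔ inside) ⊥

facets : List (Subset 14)
facets =
  t 0 1 2 6 ∷ t 0 1 4 6 ∷ t 0 1 4 10 ∷ t 0 2 6 7 ∷ t 0 3 7 11 ∷ t 0 3 8 9 ∷
  t 0 3 8 11 ∷ t 0 4 6 8 ∷ t 0 4 8 10 ∷ t 0 5 8 9 ∷ t 0 5 8 10 ∷ t 0 6 7 11 ∷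
  t 0 6 8 11 ∷ t 1 2 3 6 ∷ t 1 3 5 6 ∷ t 1 3 5 8 ∷ t 1 3 8 9 ∷ t 1 4 5 6 ∷
  t 1 4 5 7 ∷ t 1 4 7 10 ∷ t 1 5 7 8 ∷ t 1 7 8 9 ∷ t 1 7 9 10 ∷ t 2 3 6 7 ∷
  t 3 5 6 10 ∷ t 3 5 8 10 ∷ t 3 6 7 10 ∷ t 3 7 10 11 ∷ t 3 8 10 11 ∷ t 4 5 7 11 ∷
  t 4 7 10 11 ∷ t 4 8 10 11 ∷ t 5 7 8 9 ∷ t 5 7 9 11 ∷ t 6 7 9 10 ∷ t 6 7 9 11 ∷ []
  where
  t : ℕ → ℕ → ℕ → ℕ → Subset 14
  t a b c d = vertices (a ∷ b ∷ c ∷ d ∷ [])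

-- These are all of them: a boundary sphere with 12 vertices has 30 edges and 20 triangles, so B has
-- 82 triangles and, by Euler characteristic 1, 57 edges, of which 27 are interior.
interiorEdges : List (Subset 14)
interiorEdges =
  e 0 4 ∷ e 0 6 ∷ e 0 8 ∷ e 0 11 ∷ e 1 4 ∷ e 1 5 ∷ e 1 6 ∷ e 1 7 ∷ e 1 8 ∷
  e 2 6 ∷ e 3 5 ∷ e 3 6 ∷ e 3 8 ∷ e 3 10 ∷ e 3 11 ∷ e 4 7 ∷ e 4 10 ∷ e 5 7 ∷
  e 5 8 ∷ e 6 7 ∷ e 7 8 ∷ e 7 9 ∷ e 7 10 ∷ e 7 11 ∷ e 8 9 ∷ e 8 10 ∷ e 10 11 ∷ []
  where
  e : ℕ → ℕ → Subset 14
  e a b = vertices (a ∷ b ∷ [])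

-- A block `s u v a`, `s p q b`, `w r b a`, `w p q b` flips an interior edge uv with link the
-- triangle pqr: the three tetrahedra around uv become two sharing pqr. Reversed, it is the inverse
-- flip. A block `s p q b`, `w r b a`, `w p q b` deletes a boundary vertex a whose star is three
-- tetrahedra with a common edge ax, leaving the tetrahedron xpqr. The vertices 8, 4, 11, 6, 5, 10,
-- 9, 7 disappear in this order, and freed labels serve as auxiliary ones.
simplification : List (Move 14)
simplification =
  s 7 8 12 ∷ s 5 9 13 ∷ w 1 13 12 ∷ w 5 9 13 ∷ s 1 8 12 ∷ s 5 9 13 ∷ w 3 13 12 ∷ w 5 9 13 ∷
  s 8 9 12 ∷ s 0 5 13 ∷ w 3 13 12 ∷ w 0 5 13 ∷ s 5 8 12 ∷ s 0 10 13 ∷ w 3 13 12 ∷ w 0 10 13 ∷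
  s 3 8 12 ∷ s 0 10 13 ∷ w 11 13 12 ∷ w 0 10 13 ∷ s 8 10 12 ∷ s 0 4 13 ∷ w 11 13 12 ∷ w 0 4 13 ∷
  s 0 8 12 ∷ s 4 6 13 ∷ w 11 13 12 ∷ w 4 6 13 ∷ s 4 6 13 ∷ s 11 13 12 ∷ w 4 6 13 ∷ w 0 8 12 ∷
  s 4 6 12 ∷ w 11 12 8 ∷ w 4 6 12 ∷ s 3 11 8 ∷ s 0 7 12 ∷ w 10 12 8 ∷ w 0 7 12 ∷ s 10 11 8 ∷
  s 0 4 12 ∷ w 7 12 8 ∷ w 0 4 12 ∷ s 4 10 8 ∷ s 0 7 12 ∷ w 1 12 8 ∷ w 0 7 12 ∷ s 0 11 8 ∷
  s 4 6 12 ∷ w 7 12 8 ∷ w 4 6 12 ∷ s 0 4 8 ∷ s 6 7 12 ∷ w 1 12 8 ∷ w 6 7 12 ∷ s 0 6 8 ∷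
  s 1 7 12 ∷ w 2 12 8 ∷ w 1 7 12 ∷ s 2 6 8 ∷ s 1 7 12 ∷ w 3 12 8 ∷ w 1 7 12 ∷ s 1 4 8 ∷
  s 5 6 12 ∷ w 7 12 8 ∷ w 5 6 12 ∷ s 4 7 8 ∷ s 5 6 12 ∷ w 11 12 8 ∷ w 5 6 12 ∷ s 5 6 12 ∷
  s 11 12 8 ∷ w 5 6 12 ∷ w 4 7 8 ∷ s 5 6 8 ∷ w 8 11 4 ∷ w 5 6 8 ∷ s 1 6 4 ∷ s 5 7 8 ∷
  w 3 8 4 ∷ w 5 7 8 ∷ s 3 6 4 ∷ s 5 7 8 ∷ w 8 10 4 ∷ w 5 7 8 ∷ s 3 10 4 ∷ s 0 5 8 ∷
  w 7 8 4 ∷ w 0 5 8 ∷ s 1 5 4 ∷ s 7 9 8 ∷ w 3 8 4 ∷ w 7 9 8 ∷ s 7 11 4 ∷ s 5 6 8 ∷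
  w 8 9 4 ∷ w 5 6 8 ∷ s 5 6 8 ∷ s 8 9 4 ∷ w 5 6 8 ∷ w 7 11 4 ∷ s 5 6 4 ∷ w 4 9 11 ∷
  w 5 6 4 ∷ s 6 7 4 ∷ s 5 9 8 ∷ w 8 10 4 ∷ w 5 9 8 ∷ s 5 9 8 ∷ s 8 10 4 ∷ w 5 9 8 ∷
  w 6 7 4 ∷ s 5 9 4 ∷ w 4 10 6 ∷ w 5 9 4 ∷ s 3 5 4 ∷ s 0 7 6 ∷ w 6 9 4 ∷ w 0 7 6 ∷
  s 5 7 4 ∷ s 0 9 6 ∷ w 6 10 4 ∷ w 0 9 6 ∷ s 0 9 6 ∷ s 6 10 4 ∷ w 0 9 6 ∷ w 5 7 4 ∷
  s 0 9 4 ∷ w 4 10 5 ∷ w 0 9 4 ∷ s 7 10 4 ∷ s 0 9 5 ∷ w 1 5 4 ∷ w 0 9 5 ∷ s 0 1 5 ∷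
  s 5 9 4 ∷ w 0 1 5 ∷ w 7 10 4 ∷ s 0 1 4 ∷ w 4 9 10 ∷ w 0 1 4 ∷ s 7 9 4 ∷ s 0 1 5 ∷
  w 3 5 4 ∷ w 0 1 5 ∷ s 0 1 5 ∷ s 3 5 4 ∷ w 0 1 5 ∷ w 7 9 4 ∷ s 0 1 4 ∷ w 3 4 9 ∷
  w 0 1 4 ∷ s 1 7 4 ∷ s 0 2 5 ∷ w 3 5 4 ∷ w 0 2 5 ∷ s 0 2 5 ∷ s 3 5 4 ∷ w 0 2 5 ∷
  w 1 7 4 ∷ s 0 2 4 ∷ w 3 4 7 ∷ w 0 2 4 ∷ []
  where
  s w : ℕ → ℕ → ℕ → Move 14
  s u v a = subdivision (label u) (label v) (label a)
  w u v a = weld (label u) (label v) (label a)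

-- A matching of all 187 faces except the vertex 6 into 93 pairs: 36 of triangles with tetrahedra,
-- 46 of edges with triangles, 11 of vertices with edges.
freePairs : List (Subset 14 × Subset 14)
freePairs =
  f (4 ∷ 6 ∷ 8 ∷ []) 0 ∷ f (0 ∷ 1 ∷ 10 ∷ []) 4 ∷ f (1 ∷ 9 ∷ 10 ∷ []) 7 ∷
  f (6 ∷ 9 ∷ 11 ∷ []) 7 ∷ f (0 ∷ 5 ∷ 10 ∷ []) 8 ∷ f (0 ∷ 4 ∷ 6 ∷ []) 1 ∷
  f (6 ∷ 7 ∷ 9 ∷ []) 10 ∷ f (1 ∷ 4 ∷ 6 ∷ []) 5 ∷ f (6 ∷ 7 ∷ 10 ∷ []) 3 ∷
  f (7 ∷ 9 ∷ 11 ∷ []) 5 ∷ f (4 ∷ 8 ∷ 11 ∷ []) 10 ∷ f (0 ∷ 3 ∷ 7 ∷ []) 11 ∷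
  f (3 ∷ 7 ∷ 10 ∷ []) 11 ∷ f (1 ∷ 3 ∷ 9 ∷ []) 8 ∷ f (0 ∷ 1 ∷ 6 ∷ []) 2 ∷
  f (1 ∷ 4 ∷ 5 ∷ []) 7 ∷ f (7 ∷ 10 ∷ 11 ∷ []) 4 ∷ f (4 ∷ 7 ∷ 10 ∷ []) 1 ∷
  f (1 ∷ 5 ∷ 7 ∷ []) 8 ∷ f (9 ∷ 11 ∷ []) 5 ∷ f (1 ∷ 7 ∷ 9 ∷ []) 8 ∷
  f (1 ∷ 5 ∷ 8 ∷ []) 3 ∷ f (0 ∷ 4 ∷ 10 ∷ []) 8 ∷ f (0 ∷ 3 ∷ 9 ∷ []) 8 ∷
  f (6 ∷ 9 ∷ []) 10 ∷ f (0 ∷ 5 ∷ 9 ∷ []) 8 ∷ f (2 ∷ 3 ∷ 7 ∷ []) 6 ∷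
  f (1 ∷ 3 ∷ 5 ∷ []) 6 ∷ f (4 ∷ 5 ∷ 7 ∷ []) 11 ∷ f (8 ∷ 10 ∷ 11 ∷ []) 3 ∷
  f (9 ∷ 10 ∷ []) 7 ∷ f (5 ∷ 8 ∷ 10 ∷ []) 3 ∷ f (1 ∷ 5 ∷ []) 6 ∷
  f (1 ∷ 9 ∷ []) 8 ∷ f (4 ∷ 6 ∷ []) 5 ∷ f (3 ∷ 5 ∷ 10 ∷ []) 6 ∷
  f (7 ∷ 8 ∷ 9 ∷ []) 5 ∷ f (0 ∷ 3 ∷ 8 ∷ []) 11 ∷ f (5 ∷ 10 ∷ []) 6 ∷
  f (3 ∷ 9 ∷ []) 8 ∷ f (1 ∷ 2 ∷ 3 ∷ []) 6 ∷ f (0 ∷ 10 ∷ []) 8 ∷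
  f (6 ∷ 10 ∷ []) 3 ∷ f (7 ∷ 9 ∷ []) 5 ∷ f (0 ∷ 8 ∷ 11 ∷ []) 6 ∷
  f (5 ∷ 9 ∷ []) 8 ∷ f (8 ∷ 9 ∷ []) 0 ∷ f (0 ∷ 2 ∷ 6 ∷ []) 7 ∷
  f (6 ∷ 7 ∷ 11 ∷ []) 0 ∷ f (4 ∷ 5 ∷ []) 11 ∷ f (2 ∷ 3 ∷ []) 6 ∷
  f (0 ∷ 3 ∷ []) 11 ∷ f (5 ∷ 11 ∷ []) 7 ∷ f (7 ∷ 10 ∷ []) 1 ∷
  f (9 ∷ []) 0 ∷ f (5 ∷ 6 ∷ []) 3 ∷ f (5 ∷ 7 ∷ []) 8 ∷
  f (1 ∷ 10 ∷ []) 4 ∷ f (3 ∷ 5 ∷ []) 8 ∷ f (5 ∷ 8 ∷ []) 0 ∷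
  f (7 ∷ 8 ∷ []) 1 ∷ f (1 ∷ 7 ∷ []) 4 ∷ f (4 ∷ 7 ∷ []) 11 ∷
  f (1 ∷ 8 ∷ []) 3 ∷ f (1 ∷ 3 ∷ []) 6 ∷ f (3 ∷ 6 ∷ []) 7 ∷
  f (3 ∷ 7 ∷ []) 11 ∷ f (1 ∷ 6 ∷ []) 2 ∷ f (1 ∷ 2 ∷ []) 0 ∷
  f (2 ∷ 6 ∷ []) 7 ∷ f (4 ∷ 11 ∷ []) 10 ∷ f (10 ∷ 11 ∷ []) 3 ∷
  f (3 ∷ 10 ∷ []) 8 ∷ f (0 ∷ 2 ∷ []) 7 ∷ f (4 ∷ 10 ∷ []) 8 ∷
  f (5 ∷ []) 0 ∷ f (3 ∷ 11 ∷ []) 8 ∷ f (3 ∷ []) 8 ∷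
  f (4 ∷ 8 ∷ []) 0 ∷ f (6 ∷ 7 ∷ []) 0 ∷ f (0 ∷ 4 ∷ []) 1 ∷
  f (10 ∷ []) 8 ∷ f (0 ∷ 8 ∷ []) 6 ∷ f (2 ∷ []) 7 ∷
  f (0 ∷ 7 ∷ []) 11 ∷ f (8 ∷ 11 ∷ []) 6 ∷ f (0 ∷ 11 ∷ []) 6 ∷
  f (8 ∷ []) 6 ∷ f (4 ∷ []) 1 ∷ f (1 ∷ []) 0 ∷
  f (7 ∷ []) 11 ∷ f (0 ∷ []) 6 ∷ f (11 ∷ []) 6 ∷ []
  where
  f : List ℕ → ℕ → Subset 14 × Subset 14
  f σ v = vertices σ , vertices (v ∷ σ)

facets-ball : SimplicialBall 3 (generated facets)
facets-ball = connects-simplex⇒SimplicialBall {k = 10} simplification _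

facets-collapse : CollapsesTo (label 6) freePairs (faces facets)
facets-collapse = from-yes (collapsesTo? (label 6) freePairs (faces facets))

facets-obstructed : Obstructs facets interiorEdges
facets-obstructed = from-yes (obstructs? facets interiorEdges)

corollary3p24 : Σ ℕ λ n → Σ (Complex n) λ B →
    SimplicialBall 3 B ×
    Collapsible B ×
    ((σ : Subset n) (σ-facet : Facet (∂ 2 B) σ) → ¬ (B ↘ (∂ 2 B ∖ (σ , σ-facet))))
corollary3p24 = 14 , generated facets ,
  facets-ball ,
  (label 6 , collapsesTo⇒↘ (label 6) freePairs (generated facets) {faces facets}
    (lists-faces facets) facets-collapse) ,
  -- A single interior edge of B gives the contradiction; the one chosen is 0 4.
  obstructs⇒¬↘ {fs = facets} {interiorEdges} facets-obstructed (Any.here refl)
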